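{- There exists an absolute constant $C>5$ such that the following holds: if $\mathbf G=(G_1,G_2,G_3)$ is a $3$-colouring template on $n$ vertices with $|E(G_1)|\ge|E(G_2)|\ge|E(G_3)|$ and $$|E(G_1)|+|E(G_2)|+|E(G_3)|-2\binom n2-2\max\{|E(G_2)|,|E(G_3)|\}+2\sqrt{\binom n2\max\{|E(G_2)|,|E(G_3)|\}}\ \ge\ Cn,$$ then $\mathbf G$ contains a rainbow triangle.
   Context: A $3$-colouring template on a vertex set $V$ is a triple of graphs on $V$ (edge sets may overlap). A rainbow triangle is a triple of distinct vertices whose three pairs lie in the three distinct colour classes, one pair per class. -}

module Defs where

open import Data.Fin.Base using (Fin; zero; suc)
open import Data.Fin.Properties using (_<?_)
open import Data.Integer.Base using (+_)
open import Data.List.Base using (List; length; filter; allFin; cartesianProduct)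
open import Data.Nat.Base using (ℕ)
open import Data.Product.Base using (Σ-syntax; _×_; proj₁; proj₂)
open import Data.Rational.Base as ℚ using (ℚ; 0ℚ; _/_)
open import Relation.Binary.Definitions using (Decidable; Symmetric; Irreflexive)
open import Relation.Binary.PropositionalEquality.Core using (_≡_; _≢_)

record Graph (n : ℕ) : Set₁ where
  field
    Adj    : Fin n → Fin n → Set
    adj?   : Decidable Adj
    symm   : Symmetric Adj
    irrefl : Irreflexive _≡_ Adj

-- Each unordered pair of distinct vertices is represented once, as (u , v) with u < v.
vertexPairs : (n : ℕ) → List (Fin n × Fin n)
vertexPairs n = filter (λ p → proj₁ p <? proj₂ p) (cartesianProduct (allFin n) (allFin n))

∣E_∣ : ∀ {n} → Graph n → ℕ
∣E_∣ {n} G = length (filter (λ p → Graph.adj? G (proj₁ p) (proj₂ p)) (vertexPairs n))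

Template : ℕ → Set₁
Template n = Fin 3 → Graph n

pattern c₁ = zero
pattern c₂ = suc zero
pattern c₃ = suc (suc zero)

HasRainbowTriangle : ∀ {n} → Template n → Set
HasRainbowTriangle {n} 𝐆 =
  Σ[ x ∈ Fin n ] Σ[ y ∈ Fin n ] Σ[ z ∈ Fin n ]
  Σ[ i ∈ Fin 3 ] Σ[ j ∈ Fin 3 ] Σ[ k ∈ Fin 3 ]
    (x ≢ y × y ≢ z × x ≢ z) ×
    (i ≢ j × j ≢ k × i ≢ k) ×
    (Graph.Adj (𝐆 i) x y × Graph.Adj (𝐆 j) y z × Graph.Adj (𝐆 k) x z)

fromℕ : ℕ → ℚ
fromℕ k = + k / 1

-- The rational s is an upper bound for the nonnegative real square root of N (N ≥ 0).
√_≤_ : ℚ → ℚ → Set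
√ N ≤ s = 0ℚ ℚ.≤ s × N ℚ.≤ s ℚ.* s

-- The real inequality  a + 2√N ≥ b  for rational a, b and N ≥ 0.  The real number √N is
-- the infimum of the rationals s with √N ≤ s, so the inequality holds exactly when
-- a + 2s ≥ b for all of these s.
_+2√_≥_ : ℚ → ℚ → ℚ → Set
a +2√ N ≥ b = ∀ (s : ℚ) → √ N ≤ s → a ℚ.+ fromℕ 2 ℚ.* s ℚ.≥ b

infix 4 √_≤_ _+2√_≥_

{-# OPTIONS --safe #-}
module Submission where

open import Defs
open import Data.Bool.Base using (Bool; true; false; T; not; _∧_; _∨_; if_then_else_)
open import Data.Bool.Properties using (T-∧; T-∨)
open import Data.Empty using (⊥; ⊥-elim)
open import Data.Fin.Base using (Fin)
import Data.Fin.Properties as Fin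
import Data.Integer.Base as ℤ
import Data.Integer.Properties as ℤ
open import Data.List.Base using (List; []; _∷_; _++_; map; length; filter; allFin; cartesianProduct)
open import Data.List.Properties using (length-++; ++-assoc; map-++; length-tabulate)
open import Data.List.Relation.Binary.Permutation.Propositional as Perm using (_↭_; prep; swap; ↭-refl; ↭-sym; ↭-trans; ↭-reflexive)
open import Data.List.Relation.Binary.Permutation.Propositional.Properties as Permₚ using (shift; ↭-length; All-resp-↭)
open import Data.List.Relation.Unary.All as All using (All; []; _∷_)
import Data.List.Relation.Unary.All.Properties as All
open import Data.List.Relation.Unary.AllPairs using (AllPairs; []; _∷_)
open import Data.Nat.Base as ℕ using (ℕ; zero; suc; _≤_; _<_; z≤n; s≤s; _≤ᵇ_; _⊔_)
open import Data.Nat.Combinatorics using (_C_; nC1≡n; nCk+nC[k+1]≡[n+1]C[k+1])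
open import Data.Nat.ListAction using (sum)
open import Data.Nat.ListAction.Properties using (sum-++; sum-↭)
open import Data.Nat.Properties as ℕ using (≤-trans; ≤-refl; ≤-reflexive; ≤⇒≤ᵇ; ≤ᵇ⇒≤)
open import Data.Nat.Tactic.RingSolver using (solve-∀)
open import Data.Product.Base using (Σ-syntax; ∃; ∃₂; _×_; _,_; proj₁; proj₂)
open import Data.Sum.Base using (_⊎_; inj₁; inj₂; [_,_]′)
open import Function.Base using (id)
open import Function.Bundles using (Equivalence; mk⇔)
open import Relation.Binary.Definitions using (tri<; tri≈; tri>)
open import Relation.Binary.PropositionalEquality using (_≡_; _≢_; refl; sym; trans; cong; cong₂; subst; subst₂; module ≡-Reasoning)
open import Relation.Nullary using (¬_; Dec; yes; does)
open import Relation.Nullary.Decidable using (dec-true; dec-false; does-⇔; ¬?; _×-dec_; decidable-stable)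
open import Relation.Unary using (Decidable)

-- Let eᵢ = |E(Gᵢ)| and N = n C 2, let S(xy) be the set of colours of the pair xy in a
-- rainbow-free template, and call xy rich if |S(xy)| ≥ 2.  Take a matching of rich pairs such that neither a rich pair of unmatched
-- vertices nor an augmenting path of length three can enlarge it.  Let p, q, r, k be the numbers
-- of its pairs with S = {1,2}, {1,3}, {2,3}, {1,2,3}, and i the number of unmatched vertices, so
-- n = 2(p+q+r+k) + i.  No vertex sends more than two edges of colours 1 and 3 to a matched pair
-- with S ≠ {1,3}, and an unmatched vertex typically sends at most three edges to a matched pair;
-- hence e₁ + e₃ ≤ n²/2 + (2q + i/2)²/2 + O(n), and likewise e₁ + e₂ with p in place of q.
--
-- Moreover e₁ + e₂ + e₃ ≤ 3n²/4 + D² + O(n) with D = r + k + |p - q|.  A pair with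
-- S = {1,2,3} receives at most 3 edges from each vertex, and two matched pairs with different
-- two-element sets S that have at least 5 edges between them receive together at most 6 edges
-- from each vertex.  Deleting such pairs preserves the bound, as D does not grow; once all are
-- gone, at most 4 edges run between matched pairs of different kinds, and the bound is immediate.
--
-- Put m = 4 min(p,q) + i, so that n = m + 2D.  As e₃ ≤ e₂, the first bounds give
-- e₁ + e₃ ≤ n²/2 + m²/8 + O(n).  Bounding √(N e₂) by (θN + e₂/θ)/2 with θ = 1 - m/(2n) makes the
-- hypothesis linear in the eᵢ, and a convex combination of the two bounds contradicts it.

module Counting where
  open import Data.Nat.Base using (_+_; _*_)

  -- Colour sets of pairs, and finite statements about them.

  ColourSet : Set
  ColourSet = Bool × Bool × Bool

  pattern ⟨12⟩  = true  , true  , false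
  pattern ⟨13⟩  = true  , false , true
  pattern ⟨23⟩  = false , true  , true
  pattern ⟨123⟩ = true  , true  , true

  ⟦_⟧ : Bool → ℕ
  ⟦ b ⟧ = if b then 1 else 0

  size w₁₂ w₁₃ : ColourSet → ℕ
  size (a , b , c) = ⟦ a ⟧ + ⟦ b ⟧ + ⟦ c ⟧
  w₁₂  (a , b , c) = ⟦ a ⟧ + ⟦ b ⟧
  w₁₃  (a , b , c) = ⟦ a ⟧ + ⟦ c ⟧

  rich : ColourSet → Bool
  rich s = 2 ≤ᵇ size s

  rainbow free : ColourSet → ColourSet → ColourSet → Bool
  rainbow (s₁ , s₂ , s₃) (t₁ , t₂ , t₃) (u₁ , u₂ , u₃) =
      (s₁ ∧ t₂ ∧ u₃) ∨ (s₁ ∧ t₃ ∧ u₂) ∨ (s₂ ∧ t₁ ∧ u₃)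
    ∨ (s₂ ∧ t₃ ∧ u₁) ∨ (s₃ ∧ t₁ ∧ u₂) ∨ (s₃ ∧ t₂ ∧ u₁)
  free s t u = not (rainbow s t u)

  -- Statements about colour sets that are decided by evaluation on all eight of them.
  infixr 3 _⊃_
  data Formula : Set where
    all : (ColourSet → Formula) → Formula
    _⊃_ : Bool → Formula → Formula
    leq : ℕ → ℕ → Formula

  Holds : Formula → Set
  Holds (all F)   = ∀ s → Holds (F s)
  Holds (b ⊃ F)   = T b → Holds F
  Holds (leq m n) = m ≤ n

  every : (ColourSet → Bool) → Bool
  every P = bools λ a → bools λ b → bools λ c → P (a , b , c)
    where
    bools : (Bool → Bool) → Bool
    bools Q = Q false ∧ Q true

  check : Formula → Bool
  check (all F)   = every λ s → check (F s)
  check (b ⊃ F)   = if b then check F else true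
  check (leq m n) = m ≤ᵇ n

  ∧-elim : ∀ {P : Bool → Bool} → T (P false ∧ P true) → ∀ b → T (P b)
  ∧-elim {P} h b with P false in eq
  ∧-elim {P} h true  | true = h
  ∧-elim {P} h false | true rewrite eq = _

  -- Proof by reflection: for each formula used below, `check F` computes to `true`, so `_` serves
  -- as its proof and the case analysis over colour sets is left to evaluation.
  check-sound : ∀ F → T (check F) → Holds F
  check-sound (all F) h (a , b , c) =
    check-sound (F (a , b , c)) (∧-elim {P₃} (∧-elim {P₂} (∧-elim {P₁} h a) b) c)
    where
    P₃ P₂ P₁ : Bool → Bool
    P₃ z = check (F (a , b , z))
    P₂ y = check (F (a , y , false)) ∧ check (F (a , y , true))
    P₁ x = (check (F (x , false , false)) ∧ check (F (x , false , true)))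
         ∧ (check (F (x , true , false)) ∧ check (F (x , true , true)))
  check-sound (true ⊃ F) h _ = check-sound F h
  check-sound (leq m n)  h   = ≤ᵇ⇒≤ m n h

  -- Here `c` is the colour set of a pair xy, and `s`, `t` are those of zx and zy for a further
  -- vertex z. If `c` contains colour 3, colours 1 and 2 cannot be taken from different sides,
  -- whence the bound 2 for `w₁₂`; colour 2 plays the same role for `w₁₃`.
  sendsAtMost : (ColourSet → ℕ) → ℕ → ColourSet → Formula
  sendsAtMost w k c = all λ s → all λ t → free s c t ⊃ leq (w s + w t) k

  notBothRich : Formula
  notBothRich = all λ c → all λ s → all λ t →
    rich c ⊃ free s c t ⊃ not (rich s ∧ rich t) ⊃ leq (size s + size t) 3

  -- For pairs xy, uv and a vertex z: c = S(xy), d = S(uv), a = S(ux), a′ = S(uy), b = S(vx),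
  -- b′ = S(vy), s = S(zx), s′ = S(zy), t = S(zu), t′ = S(zv).  The guards are interleaved with
  -- the quantifiers to prune the evaluation.
  crossing : ColourSet → ColourSet → Formula
  crossing c d =
    all λ a → all λ b → free a d b ⊃
    all λ a′ → free a c a′ ⊃
    all λ b′ → free b c b′ ⊃ free a′ d b′ ⊃
    (5 ≤ᵇ (size a + size a′) + (size b + size b′)) ⊃
    all λ s → all λ s′ → free s c s′ ⊃
    all λ t → free t a s ⊃ free t a′ s′ ⊃
    all λ t′ → free t′ b s ⊃ free t′ b′ s′ ⊃ free t d t′ ⊃
    leq ((size s + size s′) + (size t + size t′)) 6

  size≤3 poor⇒size≤1 : Formula
  size≤3      = all λ s → leq (size s) 3
  poor⇒size≤1 = all λ s → not (rich s) ⊃ leq (size s) 1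

  -- Sums over lists.

  module _ {A : Set} where

    ∑ : List A → (A → ℕ) → ℕ
    ∑ xs f = sum (map f xs)

    ∑-++ : ∀ xs ys f → ∑ (xs ++ ys) f ≡ ∑ xs f + ∑ ys f
    ∑-++ xs ys f = trans (cong sum (map-++ f xs ys)) (sum-++ (map f xs) (map f ys))

    ∑-↭ : ∀ {xs ys} f → xs ↭ ys → ∑ xs f ≡ ∑ ys f
    ∑-↭ f p = sum-↭ (Permₚ.map⁺ f p)

    ∑-cong : ∀ xs {f g : A → ℕ} → (∀ x → f x ≡ g x) → ∑ xs f ≡ ∑ xs g
    ∑-cong []       h = refl
    ∑-cong (x ∷ xs) h = cong₂ _+_ (h x) (∑-cong xs h)

    ∑-mono : ∀ xs {f g : A → ℕ} → (∀ x → f x ≤ g x) → ∑ xs f ≤ ∑ xs g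
    ∑-mono []       h = z≤n
    ∑-mono (x ∷ xs) h = ℕ.+-mono-≤ (h x) (∑-mono xs h)

    ∑-+ : ∀ xs (f g : A → ℕ) → ∑ xs (λ x → f x + g x) ≡ ∑ xs f + ∑ xs g
    ∑-+ []       f g = refl
    ∑-+ (x ∷ xs) f g =
      trans (cong (f x + g x +_) (∑-+ xs f g)) (interchange (f x) (g x) (∑ xs f) (∑ xs g))
      where
      interchange : ∀ a b c d → a + b + (c + d) ≡ a + c + (b + d)
      interchange = solve-∀

    ∑-zero : ∀ xs → ∑ xs (λ _ → 0) ≡ 0
    ∑-zero []       = refl
    ∑-zero (x ∷ xs) = ∑-zero xs

    ∑-≤ : ∀ {f k xs} → All (λ x → f x ≤ k) xs → ∑ xs f ≤ k * length xs
    ∑-≤                   []       = z≤n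
    ∑-≤ {k = k} {x ∷ xs} (h ∷ hs) =
      ≤-trans (ℕ.+-mono-≤ h (∑-≤ hs)) (≤-reflexive (sym (ℕ.*-suc k (length xs))))

  ∑-swap : ∀ {A B : Set} (xs : List A) (ys : List B) (f : A → B → ℕ) →
    ∑ xs (λ x → ∑ ys (f x)) ≡ ∑ ys (λ y → ∑ xs (λ x → f x y))
  ∑-swap []       ys f = sym (∑-zero ys)
  ∑-swap (x ∷ xs) ys f =
    trans (cong (∑ ys (f x) +_) (∑-swap xs ys f)) (sym (∑-+ ys (f x) _))

  -- Searching lists, vertices of a list of pairs, doubled sums.

  module _ {A : Set} where

    -- The witness is brought to the head of a permuted list, so that it can be removed from the
    -- matching or from the unmatched vertices.
    search : ∀ {P Q : A → Set} → (∀ x → P x ⊎ Q x) → ∀ xs →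
      All P xs ⊎ ∃₂ λ x xs′ → xs ↭ x ∷ xs′ × Q x
    search decide [] = inj₁ []
    search decide (x ∷ xs) with decide x | search decide xs
    ... | inj₂ q | _ = inj₂ (x , xs , ↭-refl , q)
    ... | inj₁ p | inj₁ ps = inj₁ (p ∷ ps)
    ... | inj₁ p | inj₂ (y , ys , π , q) =
      inj₂ (y , x ∷ ys , ↭-trans (prep x π) (swap x y ↭-refl) , q)

    searchPairs : ∀ {P Q : A → A → Set} → (∀ x y → P x y ⊎ Q x y) → ∀ xs →
      AllPairs P xs ⊎ ∃ λ x → ∃₂ λ y xs′ → xs ↭ x ∷ y ∷ xs′ × Q x y
    searchPairs decide [] = inj₁ []
    searchPairs decide (x ∷ xs) with search (decide x) xs | searchPairs decide xs
    ... | inj₂ (y , ys , π , q) | _ = inj₂ (x , y , ys , prep x π , q)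
    ... | inj₁ ps | inj₁ pss = inj₁ (ps ∷ pss)
    ... | inj₁ ps | inj₂ (y , z , ys , π , q) =
      inj₂ (y , z , x ∷ ys , ↭-trans (prep x π) (↭-sym (shift x (y ∷ z ∷ []) ys)) , q)

    flat : List (A × A) → List A
    flat []             = []
    flat ((x , y) ∷ es) = x ∷ y ∷ flat es

    flat-++ : ∀ es fs → flat (es ++ fs) ≡ flat es ++ flat fs
    flat-++ []             fs = refl
    flat-++ ((x , y) ∷ es) fs = cong (λ l → x ∷ y ∷ l) (flat-++ es fs)

    flat-↭ : ∀ {es fs} → es ↭ fs → flat es ↭ flat fs
    flat-↭ Perm.refl                       = ↭-refl
    flat-↭ (prep (x , y) π)                = prep x (prep y (flat-↭ π))
    flat-↭ (swap (x , y) (u , v) π)        =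
      ↭-trans (prep x (prep y (prep u (prep v (flat-↭ π)))))
              (Permₚ.shifts (x ∷ y ∷ []) (u ∷ v ∷ []))
    flat-↭ (Perm.trans π ρ)                = ↭-trans (flat-↭ π) (flat-↭ ρ)

    length-flat : ∀ es → length (flat es) ≡ 2 * length es
    length-flat []       = refl
    length-flat (_ ∷ es) = trans (cong (2 +_) (length-flat es)) (sym (ℕ.*-suc 2 (length es)))

    -- For symmetric w, every pair inside xs is counted twice in double w xs xs.
    double : (A → A → ℕ) → List A → List A → ℕ
    double w xs ys = ∑ xs λ x → ∑ ys (w x)

    double-mono : ∀ {v w} xs ys → (∀ x y → v x y ≤ w x y) → double v xs ys ≤ double w xs ys
    double-mono xs ys h = ∑-mono xs λ x → ∑-mono ys (h x)

    double-+ : ∀ v w xs ys → double (λ x y → v x y + w x y) xs ys ≡ double v xs ys + double w xs ys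
    double-+ v w xs ys = trans (∑-cong xs λ x → ∑-+ ys (v x) (w x)) (∑-+ xs _ _)

    double-↭ : ∀ w {xs ys} → xs ↭ ys → double w xs xs ≡ double w ys ys
    double-↭ w {xs} {ys} π =
      trans (∑-↭ _ π) (∑-cong ys λ y → ∑-↭ (w y) π)

    module Symmetric (w : A → A → ℕ) (w-sym : ∀ x y → w x y ≡ w y x) where

      double-sym : ∀ xs ys → double w xs ys ≡ double w ys xs
      double-sym xs ys = trans (∑-swap xs ys w) (∑-cong ys λ y → ∑-cong xs λ x → w-sym x y)

      double-++ʳ : ∀ xs ys zs → double w zs (xs ++ ys) ≡ double w zs xs + double w zs ys
      double-++ʳ xs ys zs = trans (∑-cong zs λ z → ∑-++ xs ys (w z)) (∑-+ zs _ _)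

      double-++ : ∀ xs ys → double w (xs ++ ys) (xs ++ ys)
        ≡ double w xs xs + 2 * double w xs ys + double w ys ys
      double-++ xs ys = begin
        double w (xs ++ ys) (xs ++ ys)
          ≡⟨ ∑-++ xs ys _ ⟩
        double w xs (xs ++ ys) + double w ys (xs ++ ys)
          ≡⟨ cong₂ _+_ (double-++ʳ xs ys xs) (double-++ʳ xs ys ys) ⟩
        double w xs xs + double w xs ys + (double w ys xs + double w ys ys)
          ≡⟨ cong (λ k → double w xs xs + double w xs ys + (k + double w ys ys))
               (double-sym ys xs) ⟩
        double w xs xs + double w xs ys + (double w xs ys + double w ys ys)
          ≡⟨ regroup (double w xs xs) (double w xs ys) (double w ys ys) ⟩
        double w xs xs + 2 * double w xs ys + double w ys ys ∎
        where
        open ≡-Reasoning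
        regroup : ∀ a b c → a + b + (b + c) ≡ a + 2 * b + c
        regroup = solve-∀

      -- What a vertex sends into `xs` is bounded by `k`; this is applied to the vertices of `xs`
      -- for the inner pairs and to those of `ys` for the cross pairs, which are counted in both
      -- orders.
      double-peel : ∀ {k} xs ys → (∀ t → ∑ xs (w t) ≤ k) →
        double w (xs ++ ys) (xs ++ ys)
          ≤ k * length xs + 2 * (k * length ys) + double w ys ys
      double-peel {k} xs ys h = begin
        double w (xs ++ ys) (xs ++ ys)
          ≡⟨ double-++ xs ys ⟩
        double w xs xs + 2 * double w xs ys + double w ys ys
          ≡⟨ cong (λ d → double w xs xs + 2 * d + double w ys ys) (double-sym xs ys) ⟩
        double w xs xs + 2 * double w ys xs + double w ys ys
          ≤⟨ ℕ.+-monoˡ-≤ _ (ℕ.+-mono-≤ (bound xs) (ℕ.*-monoʳ-≤ 2 (bound ys))) ⟩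
        k * length xs + 2 * (k * length ys) + double w ys ys ∎
        where
        open ℕ.≤-Reasoning
        bound : ∀ zs → double w zs xs ≤ k * length zs
        bound zs = ∑-≤ (All.universal h zs)

      double-flat-≤ : ∀ {k} es ys →
        All (λ e → ∑ ys (λ t → w t (proj₁ e) + w t (proj₂ e)) ≤ k) es →
        double w (flat es) ys ≤ k * length es
      double-flat-≤ []                 ys []       = z≤n
      double-flat-≤ {k} ((x , y) ∷ es) ys (h ∷ hs) = begin
        ∑ ys (w x) + (∑ ys (w y) + double w (flat es) ys)
          ≡⟨ ℕ.+-assoc (∑ ys (w x)) _ _ ⟨
        ∑ ys (w x) + ∑ ys (w y) + double w (flat es) ys
          ≡⟨ cong (_+ double w (flat es) ys) (∑-+ ys (w x) (w y)) ⟨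
        ∑ ys (λ t → w x t + w y t) + double w (flat es) ys
          ≡⟨ cong (_+ double w (flat es) ys) (∑-cong ys λ t → cong₂ _+_ (w-sym x t) (w-sym y t)) ⟩
        ∑ ys (λ t → w t x + w t y) + double w (flat es) ys
          ≤⟨ ℕ.+-mono-≤ h (double-flat-≤ es ys hs) ⟩
        k + k * length es
          ≡⟨ ℕ.*-suc k (length es) ⟨
        k * suc (length es) ∎
        where open ℕ.≤-Reasoning

  dichotomy : ∀ b → T (not b) ⊎ T b
  dichotomy false = inj₁ _
  dichotomy true  = inj₂ _

  -- A locally maximal matching of rich pairs.

  module Colouring {V : Set} (col : V → V → ColourSet)
    (col-sym : ∀ x y → col x y ≡ col y x)
    (col-refl : ∀ x → col x x ≡ (false , false , false))
    (col-free : ∀ x y z → T (free (col x y) (col y z) (col x z)))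
    where

    Rich Poor : V → V → Set
    Rich x y = T (rich (col x y))
    Poor x y = T (not (rich (col x y)))

    -- One disjunct for each of the paths z x y z′ and z′ x y z: if its outer pairs are rich, they
    -- can replace xy and enlarge the matching.
    augments : V × V → V → V → Bool
    augments (x , y) z z′ = (rich (col z x) ∧ rich (col z′ y)) ∨ (rich (col z′ x) ∧ rich (col z y))

    Unaugmentable : List V → V × V → Set
    Unaugmentable zs e = AllPairs (λ z z′ → T (not (augments e z z′))) zs

    record Matching (xs : List V) : Set where
      field
        pairs         : List (V × V)
        rest          : List V
        covers        : flat pairs ++ rest ↭ xs
        pairs-rich    : All (λ e → Rich (proj₁ e) (proj₂ e)) pairs
        rest-poor     : AllPairs Poor rest
        unaugmentable : All (Unaugmentable rest) pairs

    recover : ∀ {xs ys} → xs ↭ ys → Matching xs → Matching ys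
    recover π M = record { Matching M ; covers = ↭-trans (Matching.covers M) π }

    -- The fuel `k` bounds the number of unmatched vertices. Every enlargement, by a rich unmatched
    -- pair or along a path of length three, uses up two of them, so it can be paid for with one
    -- unit of fuel. If neither search succeeds, the current state is the required matching.
    maximise : ∀ k es zs → length zs ≤ k →
      All (λ e → Rich (proj₁ e) (proj₂ e)) es → Matching (flat es ++ zs)
    maximise k es zs len rs
      with searchPairs (λ z z′ → dichotomy (rich (col z z′))) zs
         | search (λ e → searchPairs (λ z z′ → dichotomy (augments e z z′)) zs) es
    ... | inj₁ poor | inj₁ tight = record
      { pairs = es ; rest = zs ; covers = ↭-refl
      ; pairs-rich = rs ; rest-poor = poor ; unaugmentable = tight }
    ... | inj₂ (z , z′ , zs′ , π , r) | _
      -- Two unmatched vertices have just been found, so the fuel is not exhausted.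
      with k | ≤-trans (≤-reflexive (sym (↭-length π))) len
    ...   | suc k | s≤s len′ = recover
      (↭-trans (↭-sym (Permₚ.shifts (flat es) (z ∷ z′ ∷ []))) (Permₚ.++⁺ˡ (flat es) (↭-sym π)))
      (maximise k ((z , z′) ∷ es) zs′ (≤-trans (ℕ.n≤1+n _) len′) (r ∷ rs))
    maximise k es zs len rs | inj₁ _ | inj₂ ((x , y) , es′ , ρ , z , z′ , zs′ , π , a)
      with k | ≤-trans (≤-reflexive (sym (↭-length π))) len
    ...   | suc k | s≤s len′
      with Equivalence.to (T-∨ {rich (col z x) ∧ rich (col z′ y)}) a
    ...     | inj₁ b = recover cover (maximise k ((z , x) ∷ (z′ , y) ∷ es′) zs′
                         (≤-trans (ℕ.n≤1+n _) len′)
                         (proj₁ (Equivalence.to T-∧ b)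
                           ∷ proj₂ (Equivalence.to (T-∧ {rich (col z x)}) b)
                           ∷ All.tail (All-resp-↭ ρ rs)))
      where
      cover : flat ((z , x) ∷ (z′ , y) ∷ es′) ++ zs′ ↭ flat es ++ zs
      cover = begin
        z ∷ x ∷ z′ ∷ y ∷ flat es′ ++ zs′  ↭⟨ swap z x ↭-refl ⟩
        x ∷ z ∷ z′ ∷ y ∷ flat es′ ++ zs′  ↭⟨ prep x (shift y (z ∷ z′ ∷ []) _) ⟩
        x ∷ y ∷ z ∷ z′ ∷ flat es′ ++ zs′
          ↭⟨ prep x (prep y (Permₚ.shifts (z ∷ z′ ∷ []) (flat es′))) ⟩
        x ∷ y ∷ flat es′ ++ z ∷ z′ ∷ zs′  ↭⟨ Permₚ.++⁺ (↭-sym (flat-↭ ρ)) (↭-sym π) ⟩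
        flat es ++ zs ∎
        where open Perm.PermutationReasoning
    ...     | inj₂ b = recover cover (maximise k ((z′ , x) ∷ (z , y) ∷ es′) zs′
                         (≤-trans (ℕ.n≤1+n _) len′)
                         (proj₁ (Equivalence.to T-∧ b)
                           ∷ proj₂ (Equivalence.to (T-∧ {rich (col z′ x)}) b)
                           ∷ All.tail (All-resp-↭ ρ rs)))
      where
      cover : flat ((z′ , x) ∷ (z , y) ∷ es′) ++ zs′ ↭ flat es ++ zs
      cover = begin
        z′ ∷ x ∷ z ∷ y ∷ flat es′ ++ zs′  ↭⟨ shift z (z′ ∷ x ∷ []) _ ⟩
        z ∷ z′ ∷ x ∷ y ∷ flat es′ ++ zs′  ↭⟨ Permₚ.shifts (z ∷ z′ ∷ []) (x ∷ y ∷ flat es′) ⟩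
        x ∷ y ∷ flat es′ ++ z ∷ z′ ∷ zs′  ↭⟨ Permₚ.++⁺ (↭-sym (flat-↭ ρ)) (↭-sym π) ⟩
        flat es ++ zs ∎
        where open Perm.PermutationReasoning

    matching : ∀ xs → Matching xs
    matching xs = maximise (length xs) [] xs ≤-refl []

    -- Edges from unmatched vertices to a matched pair and among themselves.

    Kind : ColourSet → V × V → Set
    Kind c (x , y) = col x y ≡ c

    sends : ∀ w k c → T (check (sendsAtMost w k c)) → ∀ {x y} → col x y ≡ c →
      ∀ t → w (col t x) + w (col t y) ≤ k
    sends w k c h {x} {y} eq t = check-sound (sendsAtMost w k c) h _ _
      (subst (λ d → T (free (col t x) d (col t y))) eq (col-free t x y))

    weight : (ColourSet → ℕ) → V → V → ℕ
    weight f x y = f (col x y)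

    weight-sym : ∀ f x y → weight f x y ≡ weight f y x
    weight-sym f x y = cong f (col-sym x y)

    sizeTo : V × V → V → ℕ
    sizeTo (x , y) t = size (col t x) + size (col t y)

    -- A vertex that is not rich to both ends of `e` sends at most 3. One that is rich to both may
    -- send 6, but then no path through `e` being augmenting, each later vertex is rich to neither
    -- end and sends at most 3. The surplus of 3 is therefore paid only once.
    rest-bound : ∀ e zs → Rich (proj₁ e) (proj₂ e) → Unaugmentable zs e →
      ∑ zs (sizeTo e) ≤ 3 * length zs + 3
    rest-bound e       []       r []       = z≤n
    rest-bound (x , y) (z ∷ zs) r (u ∷ us) with dichotomy (rich (col z x) ∧ rich (col z y))
    ... | inj₁ h = ≤-trans
      (ℕ.+-mono-≤ (check-sound notBothRich _ (col x y) (col z x) (col z y) r (col-free z x y) h)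
                  (rest-bound (x , y) zs r us))
      (≤-reflexive (rearrange (length zs)))
      where
      rearrange : ∀ l → 3 + (3 * l + 3) ≡ 3 * suc l + 3
      rearrange = solve-∀
    ... | inj₂ h = ≤-trans
      (ℕ.+-mono-≤ (ℕ.+-mono-≤ (check-sound size≤3 _ (col z x)) (check-sound size≤3 _ (col z y)))
                  (∑-≤ (All.map (λ {z′} → others z′) u)))
      (≤-reflexive (rearrange (length zs)))
      where
      rearrange : ∀ l → 6 + 3 * l ≡ 3 * suc l + 3
      rearrange = solve-∀
      others : ∀ z′ → T (not (augments (x , y) z z′)) → sizeTo (x , y) z′ ≤ 3
      others z′ n = check-sound notBothRich _ (col x y) (col z′ x) (col z′ y) r (col-free z′ x y)
        (weaken (rich (col z x)) (rich (col z y)) (rich (col z′ x)) (rich (col z′ y)) h n)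
        where
        weaken : ∀ a b c d → T (a ∧ b) → T (not ((a ∧ d) ∨ (c ∧ b))) → T (not (c ∧ d))
        weaken true true true  false _ _ = _
        weaken true true false d     _ _ = _

    poor-bound : ∀ zs → AllPairs Poor zs → double (weight size) zs zs ≤ length zs * length zs
    poor-bound []       []       = z≤n
    poor-bound (z ∷ zs) (p ∷ ps) = begin
      double sz (z ∷ zs) (z ∷ zs)
        ≡⟨ Symmetric.double-++ sz (weight-sym size) (z ∷ []) zs ⟩
      (size (col z z) + 0) + 0 + 2 * (∑ zs (sz z) + 0) + double sz zs zs
        ≡⟨ cong (λ c → (size c + 0) + 0 + 2 * (∑ zs (sz z) + 0) + double sz zs zs) (col-refl z) ⟩
      2 * (∑ zs (sz z) + 0) + double sz zs zs
        ≤⟨ ℕ.+-mono-≤ (ℕ.*-monoʳ-≤ 2 (ℕ.+-monoˡ-≤ 0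
             (∑-≤ (All.map (λ {z′} → check-sound poor⇒size≤1 _ (col z z′)) p))))
             (poor-bound zs ps) ⟩
      2 * (1 * length zs + 0) + length zs * length zs
        ≤⟨ ℕ.n≤1+n _ ⟩
      suc (2 * (1 * length zs + 0) + length zs * length zs)
        ≡⟨ square (length zs) ⟩
      suc (length zs) * suc (length zs) ∎
      where
      open ℕ.≤-Reasoning
      sz : V → V → ℕ
      sz = weight size
      square : ∀ l → suc (2 * (1 * l + 0) + l * l) ≡ suc l * suc l
      square = solve-∀

    -- Deleting vertices without spoiling a quadratic bound.

    module _ (f : ColourSet → ℕ) where
      private
        w : V → V → ℕ
        w = weight f

      open Symmetric w (weight-sym f)

      -- With x and y the lengths of `xs` and `ys`, the condition c k = B x turns the added weight c
      -- (k x + 2 k y) into B (x² + 2 x y), exactly the growth of B y² to B (x + y)². The error `X`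
      -- is thus carried along unchanged.
      peel : ∀ {c B k X} xs ys → c * k ≡ B * length xs → (∀ t → ∑ xs (w t) ≤ k) →
        c * double w ys ys ≤ B * (length ys * length ys) + X →
        c * double w (xs ++ ys) (xs ++ ys)
          ≤ B * (length (xs ++ ys) * length (xs ++ ys)) + X
      peel {c} {B} {k} {X} xs ys ck≡Bx sent h = begin
        c * double w (xs ++ ys) (xs ++ ys)
          ≤⟨ ℕ.*-monoʳ-≤ c (double-peel xs ys sent) ⟩
        c * (k * x + 2 * (k * y) + double w ys ys)
          ≡⟨ expand c k x y (double w ys ys) ⟩
        c * k * x + 2 * (c * k * y) + c * double w ys ys
          ≤⟨ ℕ.+-monoʳ-≤ _ h ⟩
        c * k * x + 2 * (c * k * y) + (B * (y * y) + X)
          ≡⟨ cong (λ m → m * x + 2 * (m * y) + (B * (y * y) + X)) ck≡Bx ⟩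
        B * x * x + 2 * (B * x * y) + (B * (y * y) + X)
          ≡⟨ square B x y X ⟩
        B * ((x + y) * (x + y)) + X
          ≡⟨ cong (λ l → B * (l * l) + X) (length-++ xs) ⟨
        B * (length (xs ++ ys) * length (xs ++ ys)) + X ∎
        where
        open ℕ.≤-Reasoning
        x = length xs
        y = length ys
        expand : ∀ c k x y d → c * (k * x + 2 * (k * y) + d)
          ≡ c * k * x + 2 * (c * k * y) + c * d
        expand = solve-∀
        square : ∀ B x y X → B * x * x + 2 * (B * x * y) + (B * (y * y) + X)
          ≡ B * ((x + y) * (x + y)) + X
        square = solve-∀

      peelPairs : ∀ {c B k X} es ys → c * k ≡ B * 2 →
        All (λ e → ∀ t → w t (proj₁ e) + w t (proj₂ e) ≤ k) es →
        c * double w ys ys ≤ B * (length ys * length ys) + X →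
        c * double w (flat es ++ ys) (flat es ++ ys)
          ≤ B * (length (flat es ++ ys) * length (flat es ++ ys)) + X
      peelPairs                 []             ys eq []       h = h
      peelPairs {c} {B} {k} {X} ((x , y) ∷ es) ys eq (s ∷ ss) h =
        peel {c} {B} {k} {X} (x ∷ y ∷ []) (flat es ++ ys) eq
          (λ t → subst (_≤ k) (cong (w t x +_) (sym (ℕ.+-identityʳ (w t y)))) (s t))
          (peelPairs {c} {B} {k} {X} es ys eq ss h)

      flat-flat-≤ : ∀ {k} es fs →
        All (λ e → All (λ g → (w (proj₁ g) (proj₁ e) + w (proj₁ g) (proj₂ e))
                          + (w (proj₂ g) (proj₁ e) + w (proj₂ g) (proj₂ e)) ≤ k) fs) es →
        double w (flat es) (flat fs) ≤ k * length fs * length es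
      flat-flat-≤ {k} es fs hs = double-flat-≤ es (flat fs) (All.map (λ {e} → row e fs) hs)
        where
        row : ∀ e fs → All (λ g → (w (proj₁ g) (proj₁ e) + w (proj₁ g) (proj₂ e))
                          + (w (proj₂ g) (proj₁ e) + w (proj₂ g) (proj₂ e)) ≤ k) fs →
          ∑ (flat fs) (λ t → w t (proj₁ e) + w t (proj₂ e)) ≤ k * length fs
        row e []       []       = z≤n
        row e (g ∷ fs) (h ∷ hs) = ≤-trans
          (≤-reflexive (sym (ℕ.+-assoc (w (proj₁ g) (proj₁ e) + w (proj₁ g) (proj₂ e)) _ _)))
          (≤-trans (ℕ.+-mono-≤ h (row e fs hs)) (≤-reflexive (sym (ℕ.*-suc k (length fs)))))

    -- Bounds by kind, and the bound for two colour classes.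

    Good : List V → ColourSet → V × V → Set
    Good zs c e = Kind c e × Unaugmentable zs e

    -- Each of the two vertices of one pair sends at most 4 to the other pair, hence the 8.
    same-kind-bound : ∀ c → T (check (sendsAtMost size 4 c)) → ∀ {zs es} → All (Good zs c) es →
      double (weight size) (flat es) (flat es) ≤ 8 * length es * length es
    same-kind-bound c sent {es = es} good = flat-flat-≤ size es es (All.map (λ g →
      All.universal (λ h → ℕ.+-mono-≤ (sends size 4 c sent (proj₁ g) (proj₁ h))
                                      (sends size 4 c sent (proj₁ g) (proj₂ h))) es) good)

    kind-rest-bound : ∀ c → T (rich c) → ∀ {zs es} → All (Good zs c) es →
      double (weight size) (flat es) zs ≤ (3 * length zs + 3) * length es
    kind-rest-bound c c-rich {zs} {es} good =
      Symmetric.double-flat-≤ (weight size) (weight-sym size) es zs (All.map (λ {e} g →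
        rest-bound e zs (subst (λ d → T (rich d)) (sym (proj₁ g)) c-rich) (proj₂ g)) good)

    -- The pairs in `es` receive at most 2 from every vertex and are peeled off at no cost beyond
    -- n². On what remains the weight `f` is replaced by `size`: the pairs of kind `c` and the
    -- unmatched vertices account for the excess (4q + i)².
    edges-bound : ∀ f → (∀ s → f s ≤ size s) →
      ∀ {c} → T (rich c) → T (check (sendsAtMost size 4 c)) →
      ∀ es fs zs → All (λ e → ∀ t → weight f t (proj₁ e) + weight f t (proj₂ e) ≤ 2) es →
      All (Good zs c) fs → AllPairs Poor zs →
      let xs = flat es ++ flat fs ++ zs
          n = length xs ; q = length fs ; i = length zs in
      4 * double (weight f) xs xs
        ≤ 4 * (n * n) + ((4 * q + i) * (4 * q + i) + 24 * q)
    edges-bound f f≤size {c} c-rich sent es fs zs neutral good poor =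
      peelPairs f {4} {4} {2} {(4 * q + i) * (4 * q + i) + 24 * q}
        es (flat fs ++ zs) refl neutral core
      where
      open ℕ.≤-Reasoning
      q i : ℕ
      q = length fs
      i = length zs
      sz : V → V → ℕ
      sz = weight size
      open Symmetric sz (weight-sym size)
      core : 4 * double (weight f) (flat fs ++ zs) (flat fs ++ zs)
        ≤ 4 * (length (flat fs ++ zs) * length (flat fs ++ zs))
          + ((4 * q + i) * (4 * q + i) + 24 * q)
      core = begin
        4 * double (weight f) (flat fs ++ zs) (flat fs ++ zs)
          ≤⟨ ℕ.*-monoʳ-≤ 4 (double-mono (flat fs ++ zs) (flat fs ++ zs) λ x y → f≤size (col x y)) ⟩
        4 * double sz (flat fs ++ zs) (flat fs ++ zs)
          ≡⟨ cong (4 *_) (double-++ (flat fs) zs) ⟩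
        4 * (double sz (flat fs) (flat fs) + 2 * double sz (flat fs) zs + double sz zs zs)
          ≤⟨ ℕ.*-monoʳ-≤ 4 (ℕ.+-mono-≤
               (ℕ.+-mono-≤ (same-kind-bound c sent good)
                 (ℕ.*-monoʳ-≤ 2 (kind-rest-bound c c-rich good)))
               (poor-bound zs poor)) ⟩
        4 * (8 * q * q + 2 * ((3 * i + 3) * q) + i * i)
          -- An extra i² is given away to complete the square (4q + i)².
          ≤⟨ ℕ.m≤m+n _ (i * i) ⟩
        4 * (8 * q * q + 2 * ((3 * i + 3) * q) + i * i) + i * i
          ≡⟨ rearrange q i ⟩
        4 * ((2 * q + i) * (2 * q + i)) + ((4 * q + i) * (4 * q + i) + 24 * q)
          ≡⟨ cong (λ n → 4 * (n * n) + ((4 * q + i) * (4 * q + i) + 24 * q))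
               (trans (length-++ (flat fs)) (cong (_+ i) (length-flat fs))) ⟨
        _ ∎
        where
        rearrange : ∀ q i → 4 * (8 * q * q + 2 * ((3 * i + 3) * q) + i * i) + i * i
          ≡ 4 * ((2 * q + i) * (2 * q + i)) + ((4 * q + i) * (4 * q + i) + 24 * q)
        rearrange = solve-∀

    -- The bound for all three colour classes.

    cross : V × V → V × V → ℕ
    cross (x , y) (u , v) = (size (col u x) + size (col u y)) + (size (col v x) + size (col v y))

    -- As `col-free` also covers coinciding vertices, the evaluated statement applies to every `t`,
    -- including the four vertices themselves; `peel` needs this to delete them.
    crossing-low : ∀ c d → T (check (crossing c d)) → ∀ {x y u v} → col x y ≡ c → col u v ≡ d →
      4 < cross (x , y) (u , v) →
      ∀ t → ∑ (x ∷ y ∷ u ∷ v ∷ []) (weight size t) ≤ 6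
    crossing-low c d h {x} {y} {u} {v} refl refl big t =
      subst (_≤ 6) (regroup (size (col t x)) (size (col t y)) (size (col t u)) (size (col t v)))
        (check-sound (crossing c d) h
          (col u x) (col v x) (towards x)
          (col u y) (col-free u x y)
          (col v y) (col-free v x y) (towards y)
          (≤⇒≤ᵇ big)
          (col t x) (col t y) (col-free t x y)
          (col t u) (col-free t u x) (col-free t u y)
          (col t v) (col-free t v x) (col-free t v y) (col-free t u v))
      where
      -- `crossing` reads the colour sets starting from u and v, so the pairs zu and zv are
      -- reversed.
      towards : ∀ z → T (free (col u z) (col u v) (col v z))
      towards z =
        subst₂ (λ a b → T (free a (col u v) b)) (col-sym z u) (col-sym z v) (col-free z u v)
      regroup : ∀ a b c d → (a + b) + (c + d) ≡ a + (b + (c + (d + 0)))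
      regroup = solve-∀

    extract : ∀ {x y u v : V} {es fs es′ fs′} zs → es ↭ (x , y) ∷ es′ → fs ↭ (u , v) ∷ fs′ →
      flat es ++ flat fs ++ zs ↭ (x ∷ y ∷ u ∷ v ∷ []) ++ (flat es′ ++ flat fs′ ++ zs)
    extract {x} {y} {u} {v} {es′ = es′} zs π ρ = ↭-trans
      (Permₚ.++⁺ (flat-↭ π) (Permₚ.++⁺ʳ zs (flat-↭ ρ)))
      (prep x (prep y (Permₚ.shifts (flat es′) (u ∷ v ∷ []))))

    -- With `d` a bound for |p - q|, the sum r + d stands in for D while no pairs of kind {1,2,3}
    -- are present. The second summand collects the linear errors from the surplus in `rest-bound`.
    defect : ℕ → ℕ → ℕ → ℕ → ℕ
    defect p q r d = 4 * ((r + d) * (r + d)) + 12 * (p + q + r)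

    defect-mono : ∀ {p p′ q q′ r r′} d d′ → p ≤ p′ → q ≤ q′ → r ≤ r′ → r + d ≤ r′ + d′ →
      defect p q r d ≤ defect p′ q′ r′ d′
    defect-mono d d′ hp hq hr hd =
      ℕ.+-mono-≤ (ℕ.*-monoʳ-≤ 4 (ℕ.*-mono-≤ hd hd))
                 (ℕ.*-monoʳ-≤ 12 (ℕ.+-mono-≤ (ℕ.+-mono-≤ hp hq) hr))

    -- Twice the sum of the block bounds: the coefficient 8 belongs to pairs of one kind, 4 to pairs
    -- of different kinds, 3i + 3 to a pair against the unmatched vertices, and i² to the latter
    -- among themselves.
    core-size core-square : ℕ → ℕ → ℕ → ℕ → ℕ
    core-size p q r i =
      2 * (8 * p * p + 2 * (4 * q * p + (4 * r * p + (3 * i + 3) * p))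
        + (8 * q * q + 2 * (4 * r * q + (3 * i + 3) * q)
        + (8 * r * r + 2 * ((3 * i + 3) * r) + i * i)))
    core-square p q r i =
      let n = 2 * p + (2 * q + (2 * r + i)) in 3 * (n * n)

    -- For e = |p - q| in place of `d`, the right side exceeds the left by exactly i² + 16 max(p,q)
    -- r. The two hypotheses say that e ≤ d, and `defect` is monotone.
    core-arith : ∀ p q r i d → p ≤ q + d → q ≤ p + d →
      core-size p q r i ≤ core-square p q r i + defect p q r d
    core-arith p q r i d p≤ q≤ with ℕ.≤-total p q
    ... | inj₁ p≤q with e , refl ← ℕ.m≤n⇒∃[o]m+o≡n p≤q = ≤-trans
      (≤-trans (ℕ.m≤m+n _ (i * i + 16 * p * r + 16 * e * r)) (≤-reflexive (identity p e r i)))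
      (ℕ.+-monoʳ-≤ (core-square p q r i)
        (defect-mono {p} {p} {q} {q} {r} {r} e d ≤-refl ≤-refl ≤-refl
          (ℕ.+-monoʳ-≤ r (ℕ.+-cancelˡ-≤ p _ _ q≤))))
      where
      identity : ∀ p e r i →
        2 * (8 * p * p + 2 * (4 * (p + e) * p + (4 * r * p + (3 * i + 3) * p))
          + (8 * (p + e) * (p + e) + 2 * (4 * r * (p + e) + (3 * i + 3) * (p + e))
          + (8 * r * r + 2 * ((3 * i + 3) * r) + i * i)))
          + (i * i + 16 * p * r + 16 * e * r)
        ≡ 3 * ((2 * p + (2 * (p + e) + (2 * r + i))) * (2 * p + (2 * (p + e) + (2 * r + i))))
          + (4 * ((r + e) * (r + e)) + 12 * (p + (p + e) + r))
      identity = solve-∀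
    ... | inj₂ q≤p with e , refl ← ℕ.m≤n⇒∃[o]m+o≡n q≤p = ≤-trans
      (≤-trans (ℕ.m≤m+n _ (i * i + 16 * q * r + 16 * e * r)) (≤-reflexive (identity q e r i)))
      (ℕ.+-monoʳ-≤ (core-square p q r i)
        (defect-mono {p} {p} {q} {q} {r} {r} e d ≤-refl ≤-refl ≤-refl
          (ℕ.+-monoʳ-≤ r (ℕ.+-cancelˡ-≤ q _ _ p≤))))
      where
      identity : ∀ q e r i →
        2 * (8 * (q + e) * (q + e)
          + 2 * (4 * q * (q + e) + (4 * r * (q + e) + (3 * i + 3) * (q + e)))
          + (8 * q * q + 2 * (4 * r * q + (3 * i + 3) * q)
          + (8 * r * r + 2 * ((3 * i + 3) * r) + i * i)))
          + (i * i + 16 * q * r + 16 * e * r)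
        ≡ 3 * ((2 * (q + e) + (2 * q + (2 * r + i))) * (2 * (q + e) + (2 * q + (2 * r + i))))
          + (4 * ((r + e) * (r + e)) + 12 * ((q + e) + q + r))
      identity = solve-∀

    -- This is the state in which no deletion is possible any more: the doubled sum splits into
    -- blocks that are bounded one by one.
    core-bound : ∀ p q r zs d →
      All (Good zs ⟨12⟩) p → All (Good zs ⟨13⟩) q → All (Good zs ⟨23⟩) r → AllPairs Poor zs →
      length p ≤ length q + d → length q ≤ length p + d →
      All (λ e → All (λ g → cross e g ≤ 4) q) p →
      All (λ e → All (λ g → cross e g ≤ 4) r) p →
      All (λ e → All (λ g → cross e g ≤ 4) r) q →
      let xs = flat p ++ flat q ++ flat r ++ zs ; n = length xs in
      2 * double (weight size) xs xs ≤ 3 * (n * n) + defect (length p) (length q) (length r) d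
    core-bound p q r zs d gp gq gr poor p≤ q≤ pq pr qr = begin
      2 * double sz (ps ++ qs ++ rs ++ zs) (ps ++ qs ++ rs ++ zs)
        ≡⟨ cong (2 *_) expand ⟩
      2 * (double sz ps ps + 2 * (double sz ps qs + (double sz ps rs + double sz ps zs))
        + (double sz qs qs + 2 * (double sz qs rs + double sz qs zs)
        + (double sz rs rs + 2 * double sz rs zs + double sz zs zs)))
        ≤⟨ ℕ.*-monoʳ-≤ 2 (ℕ.+-mono-≤
             (ℕ.+-mono-≤ (same-kind-bound ⟨12⟩ _ gp) (ℕ.*-monoʳ-≤ 2
               (ℕ.+-mono-≤ (flat-flat-≤ size p q pq)
                 (ℕ.+-mono-≤ (flat-flat-≤ size p r pr) (kind-rest-bound ⟨12⟩ _ gp)))))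
             (ℕ.+-mono-≤
               (ℕ.+-mono-≤ (same-kind-bound ⟨13⟩ _ gq) (ℕ.*-monoʳ-≤ 2
                 (ℕ.+-mono-≤ (flat-flat-≤ size q r qr) (kind-rest-bound ⟨13⟩ _ gq))))
               (ℕ.+-mono-≤
                 (ℕ.+-mono-≤ (same-kind-bound ⟨23⟩ _ gr)
                   (ℕ.*-monoʳ-≤ 2 (kind-rest-bound ⟨23⟩ _ gr)))
                 (poor-bound zs poor)))) ⟩
      core-size (length p) (length q) (length r) i
        ≤⟨ core-arith (length p) (length q) (length r) i d p≤ q≤ ⟩
      core-square (length p) (length q) (length r) i + defect (length p) (length q) (length r) d
        ≡⟨ cong (λ n → 3 * (n * n) + defect (length p) (length q) (length r) d) length≡ ⟨
      _ ∎
      where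
      open ℕ.≤-Reasoning
      sz : V → V → ℕ
      sz = weight size
      open Symmetric sz (weight-sym size)
      ps qs rs : List V
      ps = flat p
      qs = flat q
      rs = flat r
      i : ℕ
      i = length zs
      expand : double sz (ps ++ qs ++ rs ++ zs) (ps ++ qs ++ rs ++ zs)
        ≡ double sz ps ps + 2 * (double sz ps qs + (double sz ps rs + double sz ps zs))
        + (double sz qs qs + 2 * (double sz qs rs + double sz qs zs)
        + (double sz rs rs + 2 * double sz rs zs + double sz zs zs))
      expand
        rewrite double-++ ps (qs ++ rs ++ zs) | double-++ qs (rs ++ zs) | double-++ rs zs
              | double-++ʳ qs (rs ++ zs) ps | double-++ʳ rs zs ps | double-++ʳ rs zs qs = refl
      length≡ : length (ps ++ qs ++ rs ++ zs)
        ≡ 2 * length p + (2 * length q + (2 * length r + i))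
      length≡
        rewrite length-++ ps {qs ++ rs ++ zs} | length-++ qs {rs ++ zs} | length-++ rs {zs}
              | length-flat p | length-flat q | length-flat r = refl

    findCrossing : ∀ es fs → All (λ e → All (λ g → cross e g ≤ 4) fs) es
      ⊎ ∃₂ λ e es′ → es ↭ e ∷ es′ × ∃₂ λ g fs′ → fs ↭ g ∷ fs′ × 4 < cross e g
    findCrossing es fs = search (λ e → search (λ g → ℕ.≤-<-connex (cross e g) 4) fs) es

    transfer : ∀ f {c B X Y xs ys} → ys ↭ xs → X ≤ Y →
      c * double (weight f) ys ys ≤ B * (length ys * length ys) + X →
      c * double (weight f) xs xs ≤ B * (length xs * length xs) + Y
    transfer f {c} {B} {X} {Y} {xs} {ys} π X≤Y h = begin
      c * double (weight f) xs xs      ≡⟨ cong (c *_) (double-↭ (weight f) π) ⟨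
      c * double (weight f) ys ys      ≤⟨ h ⟩
      B * (length ys * length ys) + X  ≡⟨ cong (λ l → B * (l * l) + X) (↭-length π) ⟩
      B * (length xs * length xs) + X  ≤⟨ ℕ.+-monoʳ-≤ (B * (length xs * length xs)) X≤Y ⟩
      B * (length xs * length xs) + Y  ∎
      where open ℕ.≤-Reasoning

    -- Four vertices that together receive at most 6 from each vertex can be peeled, since 2 · 6 = 3
    -- · 4.
    removeLow : ∀ {xs ys x y u v X Y} → xs ↭ (x ∷ y ∷ u ∷ v ∷ []) ++ ys →
      (∀ t → ∑ (x ∷ y ∷ u ∷ v ∷ []) (weight size t) ≤ 6) → X ≤ Y →
      2 * double (weight size) ys ys ≤ 3 * (length ys * length ys) + X →
      2 * double (weight size) xs xs ≤ 3 * (length xs * length xs) + Y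
    removeLow {ys = ys} {x} {y} {u} {v} {X} π low X≤Y h = transfer size {2} {3} (↭-sym π) X≤Y
      (peel size {2} {3} {6} {X} (x ∷ y ∷ u ∷ v ∷ []) ys refl low h)

    -- k bounds the number of deletions; d stands for |p - q| and grows by one whenever a pair of
    -- kind {2,3} is deleted, so that r + d never grows.
    total-bound : ∀ k p q r zs d → length p + length q + length r ≤ k →
      All (Good zs ⟨12⟩) p → All (Good zs ⟨13⟩) q → All (Good zs ⟨23⟩) r → AllPairs Poor zs →
      length p ≤ length q + d → length q ≤ length p + d →
      let xs = flat p ++ flat q ++ flat r ++ zs ; n = length xs in
      2 * double (weight size) xs xs ≤ 3 * (n * n) + defect (length p) (length q) (length r) d
    total-bound k p q r zs d len gp gq gr poor p≤ q≤
      with findCrossing p q | findCrossing p r | findCrossing q r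
    ... | inj₁ pq | inj₁ pr | inj₁ qr = core-bound p q r zs d gp gq gr poor p≤ q≤ pq pr qr
    ... | inj₂ (e , p′ , π , g , q′ , ρ , big) | _ | _
      with ↭-length π | ↭-length ρ | All-resp-↭ π gp | All-resp-↭ ρ gq
    ... | lp | lq | ge ∷ gp′ | gg ∷ gq′ rewrite lp | lq with k | len
    -- Both p and q lose one pair, so their difference and with it `d` stay the same.
    ... | suc k | s≤s len′ = removeLow (extract (flat r ++ zs) π ρ)
      (crossing-low ⟨12⟩ ⟨13⟩ _ (proj₁ ge) (proj₁ gg) big)
      (defect-mono {length p′} {_} {length q′} {_} {length r} d d
        (ℕ.n≤1+n _) (ℕ.n≤1+n _) ≤-refl ≤-refl)
      (total-bound k p′ q′ r zs d
        (≤-trans (ℕ.+-monoˡ-≤ (length r) (ℕ.+-monoʳ-≤ (length p′) (ℕ.n≤1+n _))) len′)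
        gp′ gq′ gr poor (ℕ.s≤s⁻¹ p≤) (ℕ.s≤s⁻¹ q≤))
    total-bound k p q r zs d len gp gq gr poor p≤ q≤
        | inj₁ _ | inj₂ (e , p′ , π , g , r′ , ρ , big) | _
      with ↭-length π | ↭-length ρ | All-resp-↭ π gp | All-resp-↭ ρ gr
    ... | lp | lr | ge ∷ gp′ | gg ∷ gr′ rewrite lp | lr with k | len
    ... | suc k | s≤s len′ = removeLow
      (↭-trans (Permₚ.++⁺ˡ (flat p) (Permₚ.shifts (flat q) (flat r)))
        (↭-trans (extract (flat q ++ zs) π ρ)
          (Permₚ.++⁺ˡ (_ ∷ _ ∷ _ ∷ _ ∷ [])
            (Permₚ.++⁺ˡ (flat p′) (Permₚ.shifts (flat r′) (flat q))))))
      (crossing-low ⟨12⟩ ⟨23⟩ _ (proj₁ ge) (proj₁ gg) big)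
      (defect-mono {length p′} {_} {length q} {_} {length r′} (suc d) d
        (ℕ.n≤1+n _) ≤-refl (ℕ.n≤1+n _) (≤-reflexive (ℕ.+-suc (length r′) d)))
      (total-bound k p′ q r′ zs (suc d)
        (≤-trans (ℕ.+-monoʳ-≤ (length p′ + length q) (ℕ.n≤1+n _)) len′)
        gp′ gq gr′ poor
        (≤-trans (≤-trans (ℕ.n≤1+n _) p≤) (ℕ.+-monoʳ-≤ (length q) (ℕ.n≤1+n d)))
        (≤-trans q≤ (≤-reflexive (sym (ℕ.+-suc (length p′) d)))))
    total-bound k p q r zs d len gp gq gr poor p≤ q≤
        | inj₁ _ | inj₁ _ | inj₂ (e , q′ , π , g , r′ , ρ , big)
      with ↭-length π | ↭-length ρ | All-resp-↭ π gq | All-resp-↭ ρ gr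
    ... | lq | lr | ge ∷ gq′ | gg ∷ gr′ rewrite lq | lr
      with k | subst (_≤ k) (cong (_+ suc (length r′)) (ℕ.+-suc (length p) (length q′))) len
    ... | suc k | s≤s len′ = removeLow
      (↭-trans (Permₚ.++⁺ˡ (flat p) (extract zs π ρ))
        (Permₚ.shifts (flat p) (_ ∷ _ ∷ _ ∷ _ ∷ [])))
      (crossing-low ⟨13⟩ ⟨23⟩ _ (proj₁ ge) (proj₁ gg) big)
      (defect-mono {length p} {_} {length q′} {_} {length r′} (suc d) d
        ≤-refl (ℕ.n≤1+n _) (ℕ.n≤1+n _) (≤-reflexive (ℕ.+-suc (length r′) d)))
      (total-bound k p q′ r′ zs (suc d)
        (≤-trans (ℕ.+-monoʳ-≤ (length p + length q′) (ℕ.n≤1+n _)) len′)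
        gp gq′ gr′ poor
        (≤-trans p≤ (≤-reflexive (sym (ℕ.+-suc (length q′) d))))
        (≤-trans (≤-trans (ℕ.n≤1+n _) q≤) (ℕ.+-monoʳ-≤ (length p) (ℕ.n≤1+n d))))

    -- Sorting the matching by kind and combining the bounds.

    record Sorted (zs : List V) : Set where
      field
        p q r k : List (V × V)
        good₁₂  : All (Good zs ⟨12⟩) p
        good₁₃  : All (Good zs ⟨13⟩) q
        good₂₃  : All (Good zs ⟨23⟩) r
        good₁₂₃ : All (Good zs ⟨123⟩) k

      sorted : List (V × V)
      sorted = p ++ q ++ r ++ k

    sort : ∀ zs es → All (λ e → Rich (proj₁ e) (proj₂ e)) es → All (Unaugmentable zs) es →
      Σ[ S ∈ Sorted zs ] Sorted.sorted S ↭ es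
    sort zs [] [] [] = record
      { p = [] ; q = [] ; r = [] ; k = []
      ; good₁₂ = [] ; good₁₃ = [] ; good₂₃ = [] ; good₁₂₃ = [] } , ↭-refl
    sort zs (e@(x , y) ∷ es) (rich-e ∷ rs) (u ∷ us)
      with sort zs es rs us | col x y in eq | rich-e
    ... | S , π | ⟨12⟩ | _ = record S { p = e ∷ p ; good₁₂ = (eq , u) ∷ good₁₂ } , prep e π
      where open Sorted S
    ... | S , π | ⟨13⟩ | _ = record S { q = e ∷ q ; good₁₃ = (eq , u) ∷ good₁₃ } ,
      ↭-trans (shift e p _) (prep e π)
      where open Sorted S
    ... | S , π | ⟨23⟩ | _ = record S { r = e ∷ r ; good₂₃ = (eq , u) ∷ good₂₃ } ,
      ↭-trans (Permₚ.++⁺ˡ p (shift e q _)) (↭-trans (shift e p _) (prep e π))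
      where open Sorted S
    ... | S , π | ⟨123⟩ | _ = record S { k = e ∷ k ; good₁₂₃ = (eq , u) ∷ good₁₂₃ } ,
      ↭-trans (Permₚ.++⁺ˡ p (Permₚ.++⁺ˡ q (shift e r _)))
        (↭-trans (Permₚ.++⁺ˡ p (shift e q _)) (↭-trans (shift e p _) (prep e π)))
      where open Sorted S
    ... | _ | false , false , false | ()
    ... | _ | false , false , true  | ()
    ... | _ | false , true  , false | ()
    ... | _ | true  , false , false | ()

    -- m = 4 min(p,q) + i and D = r + k + |p - q| in the notation of the opening comment.
    Bounds : ℕ → ℕ → List V → Set
    Bounds m D xs = let n = length xs in
      n ≡ m + 2 * D ×
      (4 * double (weight w₁₂) xs xs ≤ 4 * (n * n) + (m * m + 12 * n) ⊎
       4 * double (weight w₁₃) xs xs ≤ 4 * (n * n) + (m * m + 12 * n)) ×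
      2 * double (weight size) xs xs ≤ 3 * (n * n) + (4 * (D * D) + 6 * n)

    module MatchingBounds {xs : List V} (M : Matching xs) (S : Sorted (Matching.rest M))
      (sorts : Sorted.sorted S ↭ Matching.pairs M) where
      open Matching M renaming (rest to zs)
      open Sorted S

      n #p #q #r #k i : ℕ
      n  = length xs
      #p = length p
      #q = length q
      #r = length r
      #k = length k
      i  = length zs

      -- The bounds peel different kinds first, and doubled sums do not depend on the order of the
      -- vertices.
      arrange : ∀ es fs → es ++ fs ↭ sorted → flat es ++ flat fs ++ zs ↭ xs
      arrange es fs π = begin
        flat es ++ flat fs ++ zs    ≡⟨ ++-assoc (flat es) (flat fs) zs ⟨
        (flat es ++ flat fs) ++ zs  ≡⟨ cong (_++ zs) (flat-++ es fs) ⟨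
        flat (es ++ fs) ++ zs       ↭⟨ Permₚ.++⁺ʳ zs (flat-↭ (↭-trans π sorts)) ⟩
        flat pairs ++ zs            ↭⟨ covers ⟩
        xs                          ∎
        where open Perm.PermutationReasoning

      arrange₁₂ : flat (q ++ r ++ k) ++ flat p ++ zs ↭ xs
      arrange₁₂ = arrange (q ++ r ++ k) p (Permₚ.++-comm (q ++ r ++ k) p)

      arrange₁₃ : flat (p ++ r ++ k) ++ flat q ++ zs ↭ xs
      arrange₁₃ = arrange (p ++ r ++ k) q (↭-trans (↭-reflexive (++-assoc p (r ++ k) q))
        (Permₚ.++⁺ˡ p (Permₚ.++-comm (r ++ k) q)))

      arrangeₜ : flat k ++ flat p ++ flat q ++ flat r ++ zs ↭ xs
      arrangeₜ = ↭-trans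
        (↭-reflexive (cong (flat k ++_) (sym (begin
          flat (p ++ q ++ r) ++ zs            ≡⟨ cong (_++ zs) (flat-++ p (q ++ r)) ⟩
          (flat p ++ flat (q ++ r)) ++ zs     ≡⟨ ++-assoc (flat p) _ zs ⟩
          flat p ++ flat (q ++ r) ++ zs       ≡⟨ cong (λ l → flat p ++ l ++ zs) (flat-++ q r) ⟩
          flat p ++ (flat q ++ flat r) ++ zs  ≡⟨ cong (flat p ++_) (++-assoc (flat q) (flat r) zs) ⟩
          flat p ++ flat q ++ flat r ++ zs    ∎))))
        (arrange k (p ++ q ++ r) (↭-trans (Permₚ.++-comm k (p ++ q ++ r))
          (↭-reflexive (trans (++-assoc p (q ++ r) k) (cong (p ++_) (++-assoc q r k))))))
        where open ≡-Reasoning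

      count : n ≡ 2 * #k + (2 * #p + (2 * #q + (2 * #r + i)))
      count = trans (sym (↭-length arrangeₜ)) lengths
        where
        lengths : length (flat k ++ flat p ++ flat q ++ flat r ++ zs)
          ≡ 2 * #k + (2 * #p + (2 * #q + (2 * #r + i)))
        lengths
          rewrite length-++ (flat k) {flat p ++ flat q ++ flat r ++ zs}
                | length-++ (flat p) {flat q ++ flat r ++ zs}
                | length-++ (flat q) {flat r ++ zs} | length-++ (flat r) {zs}
                | length-flat k | length-flat p | length-flat q | length-flat r = refl

      neutral : ∀ f c → T (check (sendsAtMost f 2 c)) → ∀ {es} → All (Good zs c) es →
        All (λ e → ∀ t → weight f t (proj₁ e) + weight f t (proj₂ e) ≤ 2) es
      neutral f c sent = All.map λ g → sends f 2 c sent (proj₁ g)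

      edges₁₂ : 4 * double (weight w₁₂) xs xs
        ≤ 4 * (n * n) + ((4 * #p + i) * (4 * #p + i) + 12 * n)
      edges₁₂ = transfer w₁₂ {4} {4} arrange₁₂
        -- The linear error 24p is at most 12n because n ≥ 2p.
        (ℕ.+-monoʳ-≤ ((4 * #p + i) * (4 * #p + i)) (subst (λ n → 24 * #p ≤ 12 * n) (sym count)
          (≤-trans (ℕ.m≤m+n (24 * #p) _) (≤-reflexive (rearrange #p #q #r #k i)))))
        (edges-bound w₁₂ (check-sound (all λ s → leq (w₁₂ s) (size s)) _) _ _ (q ++ r ++ k) p zs
          (All.++⁺ (neutral w₁₂ ⟨13⟩ _ good₁₃)
            (All.++⁺ (neutral w₁₂ ⟨23⟩ _ good₂₃) (neutral w₁₂ ⟨123⟩ _ good₁₂₃)))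
          good₁₂ rest-poor)
        where
        rearrange : ∀ p q r k i → 24 * p + 12 * (2 * k + (2 * q + (2 * r + i)))
          ≡ 12 * (2 * k + (2 * p + (2 * q + (2 * r + i))))
        rearrange = solve-∀

      edges₁₃ : 4 * double (weight w₁₃) xs xs
        ≤ 4 * (n * n) + ((4 * #q + i) * (4 * #q + i) + 12 * n)
      edges₁₃ = transfer w₁₃ {4} {4} arrange₁₃
        (ℕ.+-monoʳ-≤ ((4 * #q + i) * (4 * #q + i)) (subst (λ n → 24 * #q ≤ 12 * n) (sym count)
          (≤-trans (ℕ.m≤m+n (24 * #q) _) (≤-reflexive (rearrange #p #q #r #k i)))))
        (edges-bound w₁₃ (check-sound (all λ s → leq (w₁₃ s) (size s)) _) _ _ (p ++ r ++ k) q zs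
          (All.++⁺ (neutral w₁₃ ⟨12⟩ _ good₁₂)
            (All.++⁺ (neutral w₁₃ ⟨23⟩ _ good₂₃) (neutral w₁₃ ⟨123⟩ _ good₁₂₃)))
          good₁₃ rest-poor)
        where
        rearrange : ∀ p q r k i → 24 * q + 12 * (2 * k + (2 * p + (2 * r + i)))
          ≡ 12 * (2 * k + (2 * p + (2 * q + (2 * r + i))))
        rearrange = solve-∀

      total : ∀ d → #p ≤ #q + d → #q ≤ #p + d → let D = #r + #k + d in
        2 * double (weight size) xs xs ≤ 3 * (n * n) + (4 * (D * D) + 6 * n)
      total d p≤ q≤ = transfer size {2} {3} arrangeₜ
        (ℕ.+-mono-≤ (ℕ.*-monoʳ-≤ 4 (ℕ.*-mono-≤ r+d≤ r+d≤))
          (subst (λ n → 12 * (#p + #q + #r) ≤ 6 * n) (sym count)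
            (≤-trans (ℕ.m≤m+n _ (12 * #k + 6 * i)) (≤-reflexive (rearrange #p #q #r #k i)))))
        -- Pairs of kind {1,2,3} receive at most 3 from each vertex, and 2 · 3 = 3 · 2, so they are
        -- peeled before the other three kinds are treated.
        (peelPairs size {2} {3} {3} {defect #p #q #r d} k _ refl
          (All.map (λ g → sends size 3 ⟨123⟩ _ (proj₁ g)) good₁₂₃)
          (total-bound (#p + #q + #r) p q r zs d ≤-refl good₁₂ good₁₃ good₂₃ rest-poor p≤ q≤))
        where
        r+d≤ : #r + d ≤ #r + #k + d
        r+d≤ = ℕ.+-monoˡ-≤ d (ℕ.m≤m+n #r #k)
        rearrange : ∀ p q r k i → 12 * (p + q + r) + (12 * k + 6 * i)
          ≡ 6 * (2 * k + (2 * p + (2 * q + (2 * r + i))))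
        rearrange = solve-∀

      conclude : #p ≤ #q ⊎ #q ≤ #p → ∃₂ λ m D → Bounds m D xs
      -- The less frequent of the kinds {1,2} and {1,3} gives the stronger of the two edge bounds;
      -- here it is {1,2}, and d = q - p.
      conclude (inj₁ p≤q) with d , eq ← ℕ.m≤n⇒∃[o]m+o≡n p≤q =
        4 * #p + i , #r + #k + d
        , trans count (trans (cong (λ q → 2 * #k + (2 * #p + (2 * q + (2 * #r + i)))) (sym eq))
            (rearrange #p #r #k i d))
        , inj₁ edges₁₂
        , total d (≤-trans p≤q (ℕ.m≤m+n #q d)) (≤-reflexive (sym eq))
        where
        rearrange : ∀ p r k i d → 2 * k + (2 * p + (2 * (p + d) + (2 * r + i)))
          ≡ 4 * p + i + 2 * (r + k + d)
        rearrange = solve-∀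
      conclude (inj₂ q≤p) with d , eq ← ℕ.m≤n⇒∃[o]m+o≡n q≤p =
        4 * #q + i , #r + #k + d
        , trans count (trans (cong (λ p → 2 * #k + (2 * p + (2 * #q + (2 * #r + i)))) (sym eq))
            (rearrange #q #r #k i d))
        , inj₂ edges₁₃
        , total d (≤-reflexive (sym eq)) (≤-trans q≤p (ℕ.m≤m+n #p d))
        where
        rearrange : ∀ q r k i d → 2 * k + (2 * (q + d) + (2 * q + (2 * r + i)))
          ≡ 4 * q + i + 2 * (r + k + d)
        rearrange = solve-∀

    bounds : ∀ xs → ∃₂ λ m D → Bounds m D xs
    bounds xs = MatchingBounds.conclude M (proj₁ S) (proj₂ S)
      (ℕ.≤-total (length (Sorted.p (proj₁ S))) (length (Sorted.q (proj₁ S))))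
      where
      M = matching xs
      open Matching M
      S = sort rest pairs pairs-rich unaugmentable

  -- From graphs to colour sets and edge counts.

  ∑-filter : ∀ {A : Set} {P : A → Set} (P? : Decidable P) xs f →
    ∑ (filter P? xs) f ≡ ∑ xs (λ x → if does (P? x) then f x else 0)
  ∑-filter P? []       f = refl
  ∑-filter P? (x ∷ xs) f with does (P? x)
  ... | true  = cong (f x +_) (∑-filter P? xs f)
  ... | false = ∑-filter P? xs f

  length-filter-∑ : ∀ {A : Set} {P : A → Set} (P? : Decidable P) xs →
    length (filter P? xs) ≡ ∑ xs (λ x → ⟦ does (P? x) ⟧)
  length-filter-∑ P? []       = refl
  length-filter-∑ P? (x ∷ xs) with does (P? x)
  ... | true  = cong suc (length-filter-∑ P? xs)
  ... | false = length-filter-∑ P? xs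

  ∑-cartesianProduct : ∀ {A B : Set} (xs : List A) (ys : List B) f →
    ∑ (cartesianProduct xs ys) f ≡ ∑ xs (λ x → ∑ ys (λ y → f (x , y)))
  ∑-cartesianProduct []       ys f = refl
  ∑-cartesianProduct (x ∷ xs) ys f = trans
    (∑-++ (map (x ,_) ys) (cartesianProduct xs ys) f)
    (cong₂ _+_ (∑-map ys) (∑-cartesianProduct xs ys f))
    where
    ∑-map : ∀ ys → ∑ (map (x ,_) ys) f ≡ ∑ ys (λ y → f (x , y))
    ∑-map []       = refl
    ∑-map (y ∷ ys) = cong (f (x , y) +_) (∑-map ys)

  module _ {n : ℕ} (G : Graph n) where
    open Graph G

    adjacency : Fin n → Fin n → ℕ
    adjacency x y = ⟦ does (adj? x y) ⟧

    does-sym : ∀ x y → does (adj? x y) ≡ does (adj? y x)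
    does-sym x y = does-⇔ (mk⇔ symm symm) (adj? x y) (adj? y x)

    does-refl : ∀ x → does (adj? x x) ≡ false
    does-refl x = dec-false (adj? x x) (irrefl refl)

    -- By trichotomy, the adjacency of x and y is counted in exactly one of `up x y` and `up y x`
    -- unless x = y, where it vanishes; the two resulting double sums agree after exchanging the
    -- summations.
    2*∣E∣ : 2 * ∣E G ∣ ≡ double adjacency (allFin n) (allFin n)
    2*∣E∣ = begin
      2 * ∣E G ∣
        ≡⟨ cong (2 *_) (trans (length-filter-∑ _ (vertexPairs n))
             (trans (∑-filter _ (cartesianProduct V V) _) (∑-cartesianProduct V V _))) ⟩
      2 * double up V V
        ≡⟨ cong (double up V V +_) (ℕ.+-identityʳ _) ⟩
      double up V V + double up V V
        ≡⟨ cong (double up V V +_) (∑-swap V V up) ⟩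
      double up V V + ∑ V (λ x → ∑ V (λ y → up y x))
        ≡⟨ ∑-+ V _ _ ⟨
      ∑ V (λ x → ∑ V (up x) + ∑ V (λ y → up y x))
        ≡⟨ ∑-cong V (λ x → trans (sym (∑-+ V (up x) _)) (∑-cong V (λ y → sym (split x y)))) ⟩
      double adjacency V V ∎
      where
      open ≡-Reasoning
      V : List (Fin n)
      V = allFin n
      up : Fin n → Fin n → ℕ
      up x y = if does (x Fin.<? y) then adjacency x y else 0
      split : ∀ x y → adjacency x y ≡ up x y + up y x
      split x y with Fin.<-cmp x y
      ... | tri< x<y _ y≮x rewrite dec-true (x Fin.<? y) x<y | dec-false (y Fin.<? x) y≮x =
        sym (ℕ.+-identityʳ _)
      ... | tri≈ x≮x refl _ rewrite dec-false (x Fin.<? x) x≮x | does-refl x = refl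
      ... | tri> x≮y _ y<x rewrite dec-false (x Fin.<? y) x≮y | dec-true (y Fin.<? x) y<x =
        cong ⟦_⟧ (does-sym x y)

  -- Decidability by finite search is what makes the argument by contradiction constructive.
  hasRainbowTriangle? : ∀ {n} (𝐆 : Template n) → Dec (HasRainbowTriangle 𝐆)
  hasRainbowTriangle? 𝐆 =
    Fin.any? λ x → Fin.any? λ y → Fin.any? λ z → Fin.any? λ i → Fin.any? λ j → Fin.any? λ k →
      (¬? (x Fin.≟ y) ×-dec ¬? (y Fin.≟ z) ×-dec ¬? (x Fin.≟ z)) ×-dec
      (¬? (i Fin.≟ j) ×-dec ¬? (j Fin.≟ k) ×-dec ¬? (i Fin.≟ k)) ×-dec
      (Graph.adj? (𝐆 i) x y ×-dec Graph.adj? (𝐆 j) y z ×-dec Graph.adj? (𝐆 k) x z)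

  module _ {n : ℕ} (𝐆 : Template n) where

    colours : Fin n → Fin n → ColourSet
    colours x y = has c₁ , has c₂ , has c₃
      where
      has : Fin 3 → Bool
      has i = does (Graph.adj? (𝐆 i) x y)

    colours-sym : ∀ x y → colours x y ≡ colours y x
    colours-sym x y = cong₂ _,_ (does-sym (𝐆 c₁) x y)
      (cong₂ _,_ (does-sym (𝐆 c₂) x y) (does-sym (𝐆 c₃) x y))

    colours-refl : ∀ x → colours x x ≡ (false , false , false)
    colours-refl x = cong₂ _,_ (does-refl (𝐆 c₁) x)
      (cong₂ _,_ (does-refl (𝐆 c₂) x) (does-refl (𝐆 c₃) x))

    private
      triangle : ∀ x y z i j k → i ≢ j × j ≢ k × i ≢ k →
        T (does (Graph.adj? (𝐆 i) x y) ∧ does (Graph.adj? (𝐆 j) y z)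
            ∧ does (Graph.adj? (𝐆 k) x z)) →
        HasRainbowTriangle 𝐆
      triangle x y z i j k distinct h
        with Graph.adj? (𝐆 i) x y | Graph.adj? (𝐆 j) y z | Graph.adj? (𝐆 k) x z
      ... | yes a | yes b | yes c = x , y , z , i , j , k
        -- Coinciding vertices are excluded by irreflexivity, so freeness can be stated for
        -- arbitrary x, y, z.
        , ( (λ x≡y → Graph.irrefl (𝐆 i) x≡y a)
          , (λ y≡z → Graph.irrefl (𝐆 j) y≡z b)
          , (λ x≡z → Graph.irrefl (𝐆 k) x≡z c))
        , distinct , a , b , c

      or : ∀ {a b} {A : Set} → (T a → A) → (T b → A) → T (a ∨ b) → A
      or {true}  f g = f
      or {false} f g = g

    colours-rainbow : ∀ x y z → T (rainbow (colours x y) (colours y z) (colours x z)) →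
      HasRainbowTriangle 𝐆
    colours-rainbow x y z =
      or (triangle x y z c₁ c₂ c₃ ((λ ()) , (λ ()) , (λ ())))
      (or (triangle x y z c₁ c₃ c₂ ((λ ()) , (λ ()) , (λ ())))
      (or (triangle x y z c₂ c₁ c₃ ((λ ()) , (λ ()) , (λ ())))
      (or (triangle x y z c₂ c₃ c₁ ((λ ()) , (λ ()) , (λ ())))
      (or (triangle x y z c₃ c₁ c₂ ((λ ()) , (λ ()) , (λ ())))
          (triangle x y z c₃ c₂ c₁ ((λ ()) , (λ ()) , (λ ())))))))

    colours-free : ¬ HasRainbowTriangle 𝐆 → ∀ x y z →
      T (free (colours x y) (colours y z) (colours x z))
    colours-free no-triangle x y z
      with dichotomy (rainbow (colours x y) (colours y z) (colours x z))
    ... | inj₁ f = f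
    ... | inj₂ r = ⊥-elim (no-triangle (colours-rainbow x y z r))

    private
      V : List (Fin n)
      V = allFin n

    double-w₁₂ : double (λ x y → w₁₂ (colours x y)) V V ≡ 2 * (∣E 𝐆 c₁ ∣ + ∣E 𝐆 c₂ ∣)
    double-w₁₂ = trans (double-+ _ _ V V) (trans (sym (cong₂ _+_ (2*∣E∣ (𝐆 c₁)) (2*∣E∣ (𝐆 c₂))))
      (sym (ℕ.*-distribˡ-+ 2 ∣E 𝐆 c₁ ∣ ∣E 𝐆 c₂ ∣)))

    double-w₁₃ : double (λ x y → w₁₃ (colours x y)) V V ≡ 2 * (∣E 𝐆 c₁ ∣ + ∣E 𝐆 c₃ ∣)
    double-w₁₃ = trans (double-+ _ _ V V) (trans (sym (cong₂ _+_ (2*∣E∣ (𝐆 c₁)) (2*∣E∣ (𝐆 c₃))))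
      (sym (ℕ.*-distribˡ-+ 2 ∣E 𝐆 c₁ ∣ ∣E 𝐆 c₃ ∣)))

    double-size : double (λ x y → size (colours x y)) V V
      ≡ 2 * (∣E 𝐆 c₁ ∣ + ∣E 𝐆 c₂ ∣ + ∣E 𝐆 c₃ ∣)
    double-size = trans (double-+ _ _ V V) (trans (cong₂ _+_ double-w₁₂ (sym (2*∣E∣ (𝐆 c₃))))
      (sym (ℕ.*-distribˡ-+ 2 (∣E 𝐆 c₁ ∣ + ∣E 𝐆 c₂ ∣) ∣E 𝐆 c₃ ∣)))

  EdgeBounds : ℕ → ℕ → ℕ → ℕ → ℕ → ℕ → Set
  EdgeBounds n a b c m D =
    n ≡ m + 2 * D ×
    (4 * (2 * (a + b)) ≤ 4 * (n * n) + (m * m + 12 * n) ⊎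
     4 * (2 * (a + c)) ≤ 4 * (n * n) + (m * m + 12 * n)) ×
    2 * (2 * (a + b + c)) ≤ 3 * (n * n) + (4 * (D * D) + 6 * n)

  edgeBounds : ∀ {n} (𝐆 : Template n) → ¬ HasRainbowTriangle 𝐆 →
    ∃₂ (EdgeBounds n ∣E 𝐆 c₁ ∣ ∣E 𝐆 c₂ ∣ ∣E 𝐆 c₃ ∣)
  edgeBounds {n} 𝐆 no-triangle = convert (length-tabulate {n = n} id)
    (double-w₁₂ 𝐆) (double-w₁₃ 𝐆) (double-size 𝐆) (bounds (allFin n))
    where
    open Colouring (colours 𝐆) (colours-sym 𝐆) (colours-refl 𝐆) (colours-free 𝐆 no-triangle)
      using (bounds)
    convert : ∀ {l x y z x′ y′ z′} → l ≡ n → x ≡ x′ → y ≡ y′ → z ≡ z′ →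
      ∃₂ (λ m D → l ≡ m + 2 * D ×
        (4 * x ≤ 4 * (l * l) + (m * m + 12 * l) ⊎
         4 * y ≤ 4 * (l * l) + (m * m + 12 * l)) ×
        2 * z ≤ 3 * (l * l) + (4 * (D * D) + 6 * l)) →
      ∃₂ (λ m D → n ≡ m + 2 * D ×
        (4 * x′ ≤ 4 * (n * n) + (m * m + 12 * n) ⊎
         4 * y′ ≤ 4 * (n * n) + (m * m + 12 * n)) ×
        2 * z′ ≤ 3 * (n * n) + (4 * (D * D) + 6 * n))
    convert refl refl refl refl h = h

  -- The final contradiction in natural numbers.

  2*nC2 : ∀ n → 2 * (n C 2) + n ≡ n * n
  2*nC2 zero    = refl
  2*nC2 (suc n) = begin
    2 * (suc n C 2) + suc n        ≡⟨ cong (λ k → 2 * k + suc n) (nCk+nC[k+1]≡[n+1]C[k+1] n 1) ⟨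
    2 * (n C 1 + n C 2) + suc n    ≡⟨ cong (λ k → 2 * (k + n C 2) + suc n) (nC1≡n n) ⟩
    2 * (n + n C 2) + suc n        ≡⟨ regroup n (n C 2) ⟩
    2 * (n C 2) + n + (2 * n + 1)  ≡⟨ cong (_+ (2 * n + 1)) (2*nC2 n) ⟩
    n * n + (2 * n + 1)            ≡⟨ square n ⟩
    suc n * suc n                  ∎
    where
    open ≡-Reasoning
    regroup : ∀ n k → 2 * (n + k) + suc n ≡ 2 * k + n + (2 * n + 1)
    regroup = solve-∀
    square : ∀ n → n * n + (2 * n + 1) ≡ suc n * suc n
    square = solve-∀

  -- The last inequality is the linearised hypothesis for θ = u/(2n), multiplied by 4nu; it
  -- contradicts the sum of 2nD times the first and nm times the second of the edge bounds.
  overloaded : ∀ m D N a b c → let n = m + 2 * D ; u = m + 4 * D in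
    1 ≤ n → 2 * N + n ≡ n * n →
    4 * (2 * (a + c)) ≤ 4 * (n * n) + (m * m + 12 * n) →
    2 * (2 * (a + b + c)) ≤ 3 * (n * n) + (4 * (D * D) + 6 * n) →
    6 * n * (4 * n * u) + (2 * N + 2 * b) * (4 * n * u)
      ≤ (a + b + c) * (4 * n * u) + 2 * (u * u * N + 4 * (n * n) * b) → ⊥
  overloaded m D N a b c 1≤n 2N+n≡n² E≤ T≤ h = ℕ.<⇒≱ 0<slack (ℕ.+-cancelˡ-≤ _ _ _ (begin
      upper + slack          ≡⟨ identity m D ⟩
      lower                  ≤⟨ ℕ.+-cancelˡ-≤ (8 * n * u * b) _ _ step ⟩
      load + (u * u * (n * n) + 4 * (n * n) * u)
        ≤⟨ ℕ.+-monoˡ-≤ _ (ℕ.+-mono-≤ (ℕ.*-monoʳ-≤ (n * m) T≤) (ℕ.*-monoʳ-≤ (2 * n * D) E≤)) ⟩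
      upper                  ≡⟨ ℕ.+-identityʳ upper ⟨
      upper + 0              ∎))
    where
    open ℕ.≤-Reasoning
    n u slack lower upper load : ℕ
    n = m + 2 * D
    u = m + 4 * D
    slack = n * (u * u + 14 * n * m + 56 * n * D)
    lower = 24 * (n * n) * u + 4 * n * u * (n * n) + u * u * n
    upper = n * m * (3 * (n * n) + (4 * (D * D) + 6 * n))
          + 2 * n * D * (4 * (n * n) + (m * m + 12 * n))
          + (u * u * (n * n) + 4 * (n * n) * u)
    load = n * m * (2 * (2 * (a + b + c))) + 2 * n * D * (4 * (2 * (a + c)))
    n≤u : n ≤ u
    n≤u = ℕ.+-monoʳ-≤ m (ℕ.*-monoˡ-≤ D {2} {4} (s≤s (s≤s z≤n)))
    0<slack : 0 < slack
    0<slack = ℕ.*-mono-≤ 1≤n (≤-trans (ℕ.*-mono-≤ (≤-trans 1≤n n≤u) (≤-trans 1≤n n≤u))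
      (≤-trans (ℕ.m≤m+n (u * u) _) (ℕ.m≤m+n _ (56 * n * D))))
    identity : ∀ m D →
      (m + 2 * D) * m * (3 * ((m + 2 * D) * (m + 2 * D)) + (4 * (D * D) + 6 * (m + 2 * D)))
      + 2 * (m + 2 * D) * D * (4 * ((m + 2 * D) * (m + 2 * D)) + (m * m + 12 * (m + 2 * D)))
      + ((m + 4 * D) * (m + 4 * D) * ((m + 2 * D) * (m + 2 * D))
        + 4 * ((m + 2 * D) * (m + 2 * D)) * (m + 4 * D))
      + (m + 2 * D) * ((m + 4 * D) * (m + 4 * D) + 14 * (m + 2 * D) * m + 56 * (m + 2 * D) * D)
      ≡ 24 * ((m + 2 * D) * (m + 2 * D)) * (m + 4 * D)
      + 4 * (m + 2 * D) * (m + 4 * D) * ((m + 2 * D) * (m + 2 * D))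
      + (m + 4 * D) * (m + 4 * D) * (m + 2 * D)
    identity = solve-∀
    regroupˡ : ∀ n u N b →
      6 * n * (4 * n * u) + (2 * N + 2 * b) * (4 * n * u) + (4 * n * u * n + u * u * n)
      ≡ 8 * n * u * b + (24 * (n * n) * u + 4 * n * u * (2 * N + n) + u * u * n)
    regroupˡ = solve-∀
    regroupʳ : ∀ n u N t b →
      t * (4 * n * u) + 2 * (u * u * N + 4 * (n * n) * b) + (4 * n * u * n + u * u * n)
      ≡ 4 * n * u * t + 8 * (n * n) * b + (u * u * (2 * N + n) + 4 * (n * n) * u)
    regroupʳ = solve-∀
    -- The value θ = u/(2n) and the multipliers nm and 2nD are chosen so that the coefficients of a,
    -- b and c match here.
    distribute : ∀ m D a b c →
      4 * (m + 2 * D) * (m + 4 * D) * (a + b + c) + 8 * ((m + 2 * D) * (m + 2 * D)) * b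
      ≡ 8 * (m + 2 * D) * (m + 4 * D) * b
      + ((m + 2 * D) * m * (2 * (2 * (a + b + c))) + 2 * (m + 2 * D) * D * (4 * (2 * (a + c))))
    distribute = solve-∀
    -- Adding 4n²u + u²n to both sides of the hypothesis completes each 2N to 2N + n = n².
    step : 8 * n * u * b + lower ≤ 8 * n * u * b + (load + (u * u * (n * n) + 4 * (n * n) * u))
    step = begin
      8 * n * u * b + lower
        ≡⟨ cong (λ k → 8 * n * u * b + (24 * (n * n) * u + 4 * n * u * k + u * u * n)) 2N+n≡n² ⟨
      8 * n * u * b + (24 * (n * n) * u + 4 * n * u * (2 * N + n) + u * u * n)
        ≡⟨ regroupˡ n u N b ⟨
      6 * n * (4 * n * u) + (2 * N + 2 * b) * (4 * n * u) + (4 * n * u * n + u * u * n)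
        ≤⟨ ℕ.+-monoˡ-≤ _ h ⟩
      (a + b + c) * (4 * n * u) + 2 * (u * u * N + 4 * (n * n) * b) + (4 * n * u * n + u * u * n)
        ≡⟨ regroupʳ n u N (a + b + c) b ⟩
      4 * n * u * (a + b + c) + 8 * (n * n) * b + (u * u * (2 * N + n) + 4 * (n * n) * u)
        ≡⟨ cong₂ _+_ (distribute m D a b c) (cong (λ k → u * u * k + 4 * (n * n) * u) 2N+n≡n²) ⟩
      8 * n * u * b + load + (u * u * (n * n) + 4 * (n * n) * u)
        ≡⟨ ℕ.+-assoc (8 * n * u * b) load _ ⟩
      8 * n * u * b + (load + (u * u * (n * n) + 4 * (n * n) * u)) ∎

  -- The two sides differ by the square of the distance `e` between x and y.
  am-gm : ∀ x y → 4 * (x * y) ≤ (x + y) * (x + y)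
  am-gm x y with ℕ.≤-total x y
  ... | inj₁ x≤y with e , refl ← ℕ.m≤n⇒∃[o]m+o≡n x≤y =
    ≤-trans (ℕ.m≤m+n _ (e * e)) (≤-reflexive (identity x e))
    where
    identity : ∀ x e → 4 * (x * (x + e)) + e * e ≡ (x + (x + e)) * (x + (x + e))
    identity = solve-∀
  ... | inj₂ y≤x with e , refl ← ℕ.m≤n⇒∃[o]m+o≡n y≤x =
    ≤-trans (ℕ.m≤m+n _ (e * e)) (≤-reflexive (identity y e))
    where
    identity : ∀ y e → 4 * ((y + e) * y) + e * e ≡ (y + e + y) * (y + e + y)
    identity = solve-∀

open Counting

-- Passing between rationals and naturals, and eliminating the square root.

open import Data.Rational.Base as ℚ using (ℚ; 0ℚ; _+_; _-_; _*_; toℚᵘ)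
import Data.Rational.Properties as ℚ
open import Data.Rational.Solver using (module +-*-Solver)
open import Data.Rational.Unnormalised.Base as ℚᵘ using (mkℚᵘ; *≡*; *≤*)
import Data.Rational.Unnormalised.Properties as ℚᵘ

-- Unnormalised fractions reduce the properties of `fromℕ` to integer arithmetic. The 0 encodes the
-- denominator 1, since `mkℚᵘ` stores the denominator minus one.
toℚᵘ-fromℕ : ∀ k → toℚᵘ (fromℕ k) ℚᵘ.≃ mkℚᵘ (ℤ.+ k) 0
toℚᵘ-fromℕ k = ℚ.toℚᵘ-fromℚᵘ (mkℚᵘ (ℤ.+ k) 0)

fromℕ-+ : ∀ j k → fromℕ (j ℕ.+ k) ≡ fromℕ j + fromℕ k
fromℕ-+ j k = ℚ.toℚᵘ-injective (begin-equality
  toℚᵘ (fromℕ (j ℕ.+ k))               ≃⟨ toℚᵘ-fromℕ (j ℕ.+ k) ⟩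
  mkℚᵘ (ℤ.+ (j ℕ.+ k)) 0
    ≃⟨ *≡* (cong (ℤ._* ℤ.+ 1) (sym (cong₂ ℤ._+_ (ℤ.*-identityʳ (ℤ.+ j)) (ℤ.*-identityʳ (ℤ.+ k))))) ⟩
  mkℚᵘ (ℤ.+ j) 0 ℚᵘ.+ mkℚᵘ (ℤ.+ k) 0   ≃⟨ ℚᵘ.+-cong (toℚᵘ-fromℕ j) (toℚᵘ-fromℕ k) ⟨
  toℚᵘ (fromℕ j) ℚᵘ.+ toℚᵘ (fromℕ k)   ≃⟨ ℚ.toℚᵘ-homo-+ (fromℕ j) (fromℕ k) ⟨
  toℚᵘ (fromℕ j + fromℕ k)             ∎)
  where open ℚᵘ.≤-Reasoning

fromℕ-* : ∀ j k → fromℕ (j ℕ.* k) ≡ fromℕ j * fromℕ k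
fromℕ-* j k = ℚ.toℚᵘ-injective (begin-equality
  toℚᵘ (fromℕ (j ℕ.* k))               ≃⟨ toℚᵘ-fromℕ (j ℕ.* k) ⟩
  mkℚᵘ (ℤ.+ (j ℕ.* k)) 0               ≃⟨ *≡* (cong (ℤ._* ℤ.+ 1) (ℤ.pos-* j k)) ⟩
  mkℚᵘ (ℤ.+ j) 0 ℚᵘ.* mkℚᵘ (ℤ.+ k) 0   ≃⟨ ℚᵘ.*-cong (toℚᵘ-fromℕ j) (toℚᵘ-fromℕ k) ⟨
  toℚᵘ (fromℕ j) ℚᵘ.* toℚᵘ (fromℕ k)   ≃⟨ ℚ.toℚᵘ-homo-* (fromℕ j) (fromℕ k) ⟨
  toℚᵘ (fromℕ j * fromℕ k)             ∎)
  where open ℚᵘ.≤-Reasoning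

fromℕ-mono-≤ : ∀ {j k} → j ℕ.≤ k → fromℕ j ℚ.≤ fromℕ k
fromℕ-mono-≤ {j} {k} j≤k = ℚ.toℚᵘ-cancel-≤ (begin
  toℚᵘ (fromℕ j)   ≃⟨ toℚᵘ-fromℕ j ⟩
  mkℚᵘ (ℤ.+ j) 0   ≤⟨ *≤* (ℤ.*-monoʳ-≤-nonNeg (ℤ.+ 1) (ℤ.+≤+ j≤k)) ⟩
  mkℚᵘ (ℤ.+ k) 0   ≃⟨ toℚᵘ-fromℕ k ⟨
  toℚᵘ (fromℕ k)   ∎)
  where open ℚᵘ.≤-Reasoning

fromℕ-cancel-≤ : ∀ {j k} → fromℕ j ℚ.≤ fromℕ k → j ℕ.≤ k
fromℕ-cancel-≤ {j} {k} h with begin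
  mkℚᵘ (ℤ.+ j) 0   ≃⟨ toℚᵘ-fromℕ j ⟨
  toℚᵘ (fromℕ j)   ≤⟨ ℚ.toℚᵘ-mono-≤ h ⟩
  toℚᵘ (fromℕ k)   ≃⟨ toℚᵘ-fromℕ k ⟩
  mkℚᵘ (ℤ.+ k) 0   ∎
  where open ℚᵘ.≤-Reasoning
... | *≤* i≤j = ℤ.drop‿+≤+ (ℤ.*-cancelʳ-≤-pos (ℤ.+ j) (ℤ.+ k) (ℤ.+ 1) i≤j)

-- The hypothesis holds for every rational upper bound of the root, in particular for s = num/den,
-- which the first inequality certifies as such a bound. Multiplication by `den` returns to natural
-- numbers.
test-sqrt : ∀ t N M k num den .{{_ : ℕ.NonZero den}} →
  N ℕ.* M ℕ.* (den ℕ.* den) ℕ.≤ num ℕ.* num →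
  (fromℕ t - fromℕ 2 * fromℕ N - fromℕ 2 * fromℕ M) +2√ (fromℕ N * fromℕ M) ≥ fromℕ k →
  k ℕ.* den ℕ.+ (2 ℕ.* N ℕ.+ 2 ℕ.* M) ℕ.* den ℕ.≤ t ℕ.* den ℕ.+ 2 ℕ.* num
test-sqrt t N M k num den amgm h = fromℕ-cancel-≤ (begin
  fromℕ (k ℕ.* den ℕ.+ (2 ℕ.* N ℕ.+ 2 ℕ.* M) ℕ.* den)
    ≡⟨ cong fromℕ (ℕ.*-distribʳ-+ den k _) ⟨
  fromℕ ((k ℕ.+ (2 ℕ.* N ℕ.+ 2 ℕ.* M)) ℕ.* den)
    ≡⟨ trans (fromℕ-* (k ℕ.+ (2 ℕ.* N ℕ.+ 2 ℕ.* M)) den)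
             (cong (_* d) (trans (fromℕ-+ k _) (cong (fromℕ k +_) twice))) ⟩
  (fromℕ k + (fromℕ 2 * fromℕ N + fromℕ 2 * fromℕ M)) * d
    ≤⟨ ℚ.*-monoʳ-≤-nonNeg d {{ℚ.pos⇒nonNeg d}} (ℚ.+-monoˡ-≤ _ (h s (0≤s , N*M≤s*s))) ⟩
  (fromℕ t - fromℕ 2 * fromℕ N - fromℕ 2 * fromℕ M + fromℕ 2 * s
    + (fromℕ 2 * fromℕ N + fromℕ 2 * fromℕ M)) * d
    ≡⟨ solve 6 (λ t x N M s d → (t :- x :* N :- x :* M :+ x :* s :+ (x :* N :+ x :* M)) :* d
                 := t :* d :+ x :* (s :* d)) refl (fromℕ t) (fromℕ 2) (fromℕ N) (fromℕ M) s d ⟩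
  fromℕ t * d + fromℕ 2 * (s * d)
    ≡⟨ cong (λ x → fromℕ t * d + fromℕ 2 * x) s*d ⟩
  fromℕ t * d + fromℕ 2 * fromℕ num
    ≡⟨ trans (fromℕ-+ (t ℕ.* den) _) (cong₂ _+_ (fromℕ-* t den) (fromℕ-* 2 num)) ⟨
  fromℕ (t ℕ.* den ℕ.+ 2 ℕ.* num) ∎)
  where
  open ℚ.≤-Reasoning
  open +-*-Solver
  d s : ℚ
  d = fromℕ den
  instance
    d-pos : ℚ.Positive d
    d-pos = ℚ.normalize-pos den 1
    d-nonZero : ℚ.NonZero d
    d-nonZero = ℚ.pos⇒nonZero d
  s = fromℕ num * ℚ.1/ d
  twice : fromℕ (2 ℕ.* N ℕ.+ 2 ℕ.* M) ≡ fromℕ 2 * fromℕ N + fromℕ 2 * fromℕ M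
  twice = trans (fromℕ-+ (2 ℕ.* N) (2 ℕ.* M)) (cong₂ _+_ (fromℕ-* 2 N) (fromℕ-* 2 M))
  s*d : s * d ≡ fromℕ num
  s*d = trans (ℚ.*-assoc (fromℕ num) (ℚ.1/ d) d)
    (trans (cong (fromℕ num *_) (ℚ.*-inverseˡ d)) (ℚ.*-identityʳ (fromℕ num)))
  0≤s : 0ℚ ℚ.≤ s
  0≤s = ℚ.*-cancelʳ-≤-pos d
    (subst₂ ℚ._≤_ (sym (ℚ.*-zeroˡ d)) (sym s*d) (fromℕ-mono-≤ {0} {num} z≤n))
  N*M≤s*s : fromℕ N * fromℕ M ℚ.≤ s * s
  N*M≤s*s = ℚ.*-cancelʳ-≤-pos (d * d) {{ℚ.pos*pos⇒pos d d}} (begin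
    fromℕ N * fromℕ M * (d * d)
      ≡⟨ trans (fromℕ-* (N ℕ.* M) _) (cong₂ _*_ (fromℕ-* N M) (fromℕ-* den den)) ⟨
    fromℕ (N ℕ.* M ℕ.* (den ℕ.* den))
      ≤⟨ fromℕ-mono-≤ amgm ⟩
    fromℕ (num ℕ.* num)
      ≡⟨ trans (fromℕ-* num num) (sym (cong₂ _*_ s*d s*d)) ⟩
    s * d * (s * d)
      ≡⟨ solve 2 (λ s d → s :* d :* (s :* d) := s :* s :* (d :* d)) refl s d ⟩
    s * s * (d * d) ∎)

edgeBounds-contradict : ∀ n a b c m D → 1 ≤ n → c ≤ b → EdgeBounds n a b c m D →
  ¬ ((fromℕ a + fromℕ b + fromℕ c - fromℕ 2 * fromℕ (n C 2) - fromℕ 2 * fromℕ (b ⊔ c))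
      +2√ (fromℕ (n C 2) * fromℕ (b ⊔ c)) ≥ (fromℕ 6 * fromℕ n))
edgeBounds-contradict n a b c m D 1≤n c≤b (refl , edges , T≤) hyp =
  overloaded m D N a b c 1≤n (2*nC2 n) E≤ T≤
    (test-sqrt (a ℕ.+ b ℕ.+ c) N b (6 ℕ.* n) num den {{den-nonZero}} amgm hyp′)
  where
  N u num den : ℕ
  N = n C 2
  u = m ℕ.+ 4 ℕ.* D
  -- The fraction num/den is (θN + b/θ)/2 for θ = u/(2n), an upper bound for √(N b) by the
  -- inequality of arithmetic and geometric means.
  num = u ℕ.* u ℕ.* N ℕ.+ 4 ℕ.* (n ℕ.* n) ℕ.* b
  den = 4 ℕ.* n ℕ.* u
  -- Whichever of the two edge bounds is available, c ≤ b turns it into a bound on a + c.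
  E≤ : 4 ℕ.* (2 ℕ.* (a ℕ.+ c)) ≤ 4 ℕ.* (n ℕ.* n) ℕ.+ (m ℕ.* m ℕ.+ 12 ℕ.* n)
  E≤ = [ ≤-trans (ℕ.*-monoʳ-≤ 4 (ℕ.*-monoʳ-≤ 2 (ℕ.+-monoʳ-≤ a c≤b))) , id ]′ edges
  1≤u : 1 ≤ u
  1≤u = ≤-trans 1≤n (ℕ.+-monoʳ-≤ m (ℕ.*-monoˡ-≤ D {2} {4} (s≤s (s≤s z≤n))))
  den-nonZero : ℕ.NonZero den
  den-nonZero = ℕ.>-nonZero (ℕ.*-mono-≤ {1} {4 ℕ.* n} (≤-trans 1≤n (ℕ.m≤m+n n _)) 1≤u)
  amgm : N ℕ.* b ℕ.* (den ℕ.* den) ≤ num ℕ.* num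
  amgm = ≤-trans (≤-reflexive (rearrange N b n u)) (am-gm (u ℕ.* u ℕ.* N) (4 ℕ.* (n ℕ.* n) ℕ.* b))
    where
    rearrange : ∀ N b n u → N ℕ.* b ℕ.* (4 ℕ.* n ℕ.* u ℕ.* (4 ℕ.* n ℕ.* u))
      ≡ 4 ℕ.* (u ℕ.* u ℕ.* N ℕ.* (4 ℕ.* (n ℕ.* n) ℕ.* b))
    rearrange = solve-∀
  hyp′ : (fromℕ (a ℕ.+ b ℕ.+ c) - fromℕ 2 * fromℕ N - fromℕ 2 * fromℕ b)
    +2√ (fromℕ N * fromℕ b) ≥ fromℕ (6 ℕ.* n)
  hyp′ = subst₂
    (λ x y → (x - fromℕ 2 * fromℕ N - fromℕ 2 * fromℕ b) +2√ (fromℕ N * fromℕ b) ≥ y)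
    (sym (trans (fromℕ-+ (a ℕ.+ b) c) (cong (_+ fromℕ c) (fromℕ-+ a b)))) (sym (fromℕ-* 6 n))
    (subst (λ M → (fromℕ a + fromℕ b + fromℕ c - fromℕ 2 * fromℕ N - fromℕ 2 * fromℕ M)
      +2√ (fromℕ N * fromℕ M) ≥ (fromℕ 6 * fromℕ n)) (ℕ.m≥n⇒m⊔n≡m c≤b) hyp)

mainTheorem9 : Σ[ c ∈ ℚ ] (c ℚ.> fromℕ 5) ×
    ((n : ℕ) → n ℕ.≥ 1 → (𝐆 : Template n) →
    ∣E 𝐆 c₁ ∣ ℕ.≥ ∣E 𝐆 c₂ ∣ →
    ∣E 𝐆 c₂ ∣ ℕ.≥ ∣E 𝐆 c₃ ∣ →
    (fromℕ ∣E 𝐆 c₁ ∣ + fromℕ ∣E 𝐆 c₂ ∣ + fromℕ ∣E 𝐆 c₃ ∣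
    - fromℕ 2 * fromℕ (n C 2)
    - fromℕ 2 * fromℕ (∣E 𝐆 c₂ ∣ ⊔ ∣E 𝐆 c₃ ∣))
    +2√ (fromℕ (n C 2) * fromℕ (∣E 𝐆 c₂ ∣ ⊔ ∣E 𝐆 c₃ ∣))
    ≥ (c * fromℕ n) →
    HasRainbowTriangle 𝐆)
mainTheorem9 = fromℕ 6 , ℚ.*<* (ℤ.+<+ (ℕ.n<1+n 5)) , λ n 1≤n 𝐆 _ c≤b hyp →
  -- It suffices to refute the absence of a rainbow triangle.
  decidable-stable (hasRainbowTriangle? 𝐆) λ no-triangle →
    let m , D , B = edgeBounds 𝐆 no-triangle in
    edgeBounds-contradict n ∣E 𝐆 c₁ ∣ ∣E 𝐆 c₂ ∣ ∣E 𝐆 c₃ ∣ m D 1≤n c≤b B hyp
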